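{- There is a constant $c>0$ such that $\tau_{\pm1}(d)\ge (cd)^{d/4}$ for all $d$ that are powers of $2$.
   Context: For an integer $d\ge1$, $\tau_{\pm1}(d)$ denotes the largest integer $t$ for which there exist vectors $\mathbf{v}_1,\ldots,\mathbf{v}_t\in\{ -1,+1\}^d$ such that (i) $\mathbf{v}_1+\cdots+\mathbf{v}_t\in[-1,1]^d$, and (ii) for every $S\subset\{1,\ldots,t\}$ with $2\le|S|<t$, the sum $\sum_{i\in S}\mathbf{v}_i$ does not lie in $[-1,1]^d$. -}

module Defs where

open import Data.Nat using (ℕ; zero; suc)
open import Data.Integer using (ℤ; +_; -[1+_]; _+_; _≤_; 0ℤ; 1ℤ; -1ℤ)
open import Data.Fin using (Fin; zero; suc)
open import Data.Fin.Subset using (Subset; ∣_∣)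
open import Data.Vec using (lookup)
open import Data.Bool using (if_then_else_)
open import Data.Product using (_×_; ∃)
open import Data.Sum using (_⊎_)
open import Relation.Nullary using (¬_)
open import Relation.Binary.PropositionalEquality using (_≡_)
open import Data.Rational using (ℚ; 1ℚ; _*_)
import Data.Nat as ℕ

sumFin : ∀ {t} → (Fin t → ℤ) → ℤ
sumFin {zero} f = 0ℤ
sumFin {suc t} f = f zero + sumFin (λ i → f (suc i))

Family : ℕ → ℕ → Set
Family d t = Fin t → Fin d → ℤ

IsSign : ℤ → Set
IsSign x = x ≡ 1ℤ ⊎ x ≡ -1ℤ

InBox : ∀ {d} → (Fin d → ℤ) → Set
InBox {d} w = ∀ (j : Fin d) → (-1ℤ ≤ w j) × (w j ≤ 1ℤ)

subsetSum : ∀ {d t} → Family d t → Subset t → Fin d → ℤ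
subsetSum v S j = sumFin (λ i → if lookup S i then v i j else 0ℤ)

totalSum : ∀ {d t} → Family d t → Fin d → ℤ
totalSum v j = sumFin (λ i → v i j)

-- conditions defining τ_{±1}(d): v_1..v_t ∈ {-1,1}^d, (i), (ii)
Valid : (d t : ℕ) → Family d t → Set
Valid d t v =
  (∀ i j → IsSign (v i j)) ×
  InBox (totalSum v) ×
  (∀ (S : Subset t) → 2 ℕ.≤ ∣ S ∣ → ∣ S ∣ ℕ.< t → ¬ InBox (subsetSum v S))

Admissible : ℕ → ℕ → Set
Admissible d t = ∃ λ (v : Family d t) → Valid d t v

_^ℚ_ : ℚ → ℕ → ℚ
q ^ℚ zero = 1ℚ
q ^ℚ suc n = q * (q ^ℚ n)

ℕtoℚ : ℕ → ℚ
ℕtoℚ n = Data.Rational._/_ (+ n) 1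

module Submission where

-- Let n = 2^m = d / 2 and take the columns (± b_x, ε_x a_x), where the b_x are the columns of the Sylvester
-- matrix, the a_x those of a sign matrix A, and the ε_x are signs.  If a collection has its sum in the box,
-- then by Parseval the numbers of + and − copies of the columns differ in at most one x and by at most one;
-- the other n coordinates and a parity argument then put one of the two multiplicity vectors into the
-- kernel of A (twisted by ε).  So it suffices that A has a nonzero integral kernel and that all its nonzero
-- integral kernel vectors are huge: ε is chosen so that one of them becomes nonnegative, and a minimal
-- subcollection of size at least 2 of the collection it defines is as required.
--
-- A is a variant of Håstad's ill-conditioned matrix.  Run through the subsets of [m] with at least five
-- elements in binary order.  For consecutive β, α the row x ↦ (χ α x if x vanishes on α ∩ β, else χ β x)
-- forces the Fourier coefficients z of a kernel vector to satisfy |z α| ≥ 2^(|α| − 2) |z β|, because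
-- |α ∩ β| = |α| − 1 and all other coefficients involved come earlier, hence are much smaller.  The
-- exponents add up to at least n m / 2 − 5 n.

open import Defs
open import Data.Bool using (Bool; true; false; if_then_else_; not; _∧_)
import Data.Bool.Properties as Boolₚ
open import Data.Fin using (Fin; zero; suc; combine; remQuot)
import Data.Fin.Properties as Finₚ
open import Data.Fin.Subset as Subset using (Subset)
open import Data.Fin.Subset.Properties using (anySubset?)
open import Data.Integer as ℤ using (ℤ; +_; 0ℤ; 1ℤ; -1ℤ; ∣_∣)
import Data.Integer.Properties as ℤₚ
open import Data.Integer.Tactic.RingSolver using (solve-∀)
open import Data.List as List using (List; []; _∷_; _++_; length)
import Data.List.Properties as Listₚ
open import Data.Nat as ℕ using (ℕ; zero; suc; pred; _∸_; _^_)
import Data.Nat.Properties as ℕₚ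
import Data.Nat.Tactic.RingSolver as ℕSolver
open import Data.Product using (_×_; _,_; proj₁; proj₂; ∃)
import Data.Rational as ℚ
import Data.Rational.Properties as ℚₚ
import Data.Rational.Unnormalised as ℚᵘ
import Data.Rational.Unnormalised.Properties as ℚᵘₚ
open import Data.Sum using (_⊎_; inj₁; inj₂; [_,_]′)
open import Data.Vec using (Vec; []; _∷_; replicate)
open import Data.Vec.Properties using (≡-dec; ∷-injectiveʳ)
open import Function using (_∘_; id; Inverse)
open import Relation.Binary.Definitions using (DecidableEquality)
open import Relation.Binary.PropositionalEquality
open import Relation.Nullary using (¬_; Dec; yes; no; contradiction)
open import Relation.Nullary.Decidable using (_×-dec_)

module Construction where

  open import Data.Integer using (_+_; _*_; -_; _-_)

  -- Sums over the cube, Walsh characters and Parseval's identity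

  Cube : ℕ → Set
  Cube m = Vec Bool m

  ∑ : ∀ {m} → (Cube m → ℤ) → ℤ
  ∑ {zero}  h = h []
  ∑ {suc m} h = ∑ (h ∘ (false ∷_)) + ∑ (h ∘ (true ∷_))

  ∑-cong : ∀ {m} {f g : Cube m → ℤ} → (∀ x → f x ≡ g x) → ∑ f ≡ ∑ g
  ∑-cong {zero}  e = e []
  ∑-cong {suc m} e = cong₂ _+_ (∑-cong (e ∘ (false ∷_))) (∑-cong (e ∘ (true ∷_)))

  +-interchange : ∀ a b c d → (a + b) + (c + d) ≡ (a + c) + (b + d)
  +-interchange = solve-∀

  ∑-+ : ∀ {m} (f g : Cube m → ℤ) → ∑ (λ x → f x + g x) ≡ ∑ f + ∑ g
  ∑-+ {zero}  f g = refl
  ∑-+ {suc m} f g = trans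
    (cong₂ _+_ (∑-+ (f ∘ (false ∷_)) (g ∘ (false ∷_))) (∑-+ (f ∘ (true ∷_)) (g ∘ (true ∷_))))
    (+-interchange (∑ (f ∘ (false ∷_))) (∑ (g ∘ (false ∷_))) (∑ (f ∘ (true ∷_))) (∑ (g ∘ (true ∷_))))

  ∑-* : ∀ {m} c (f : Cube m → ℤ) → ∑ (λ x → c * f x) ≡ c * ∑ f
  ∑-* {zero}  c f = refl
  ∑-* {suc m} c f = trans
    (cong₂ _+_ (∑-* c (f ∘ (false ∷_))) (∑-* c (f ∘ (true ∷_))))
    (sym (ℤₚ.*-distribˡ-+ c _ _))

  ∑-neg : ∀ {m} (f : Cube m → ℤ) → ∑ (λ x → - f x) ≡ - ∑ f
  ∑-neg f = trans (∑-cong (λ x → sym (ℤₚ.-1*i≡-i (f x)))) (trans (∑-* -1ℤ f) (ℤₚ.-1*i≡-i _))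

  ∑-mono : ∀ {m} {f g : Cube m → ℤ} → (∀ x → f x ℤ.≤ g x) → ∑ f ℤ.≤ ∑ g
  ∑-mono {zero}  e = e []
  ∑-mono {suc m} e = ℤₚ.+-mono-≤ (∑-mono (e ∘ (false ∷_))) (∑-mono (e ∘ (true ∷_)))

  *-double : ∀ a c → a * c + a * c ≡ (+ 2 * a) * c
  *-double = solve-∀

  ∑-const : ∀ m c → ∑ {m} (λ _ → c) ≡ + (2 ^ m) * c
  ∑-const zero    c = sym (ℤₚ.*-identityˡ c)
  ∑-const (suc m) c = begin
    ∑ {m} (λ _ → c) + ∑ {m} (λ _ → c)        ≡⟨ cong₂ _+_ (∑-const m c) (∑-const m c) ⟩
    + (2 ^ m) * c + + (2 ^ m) * c        ≡⟨ *-double (+ (2 ^ m)) c ⟩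
    (+ 2 * + (2 ^ m)) * c                  ≡⟨ cong (_* c) (sym (ℤₚ.pos-* 2 (2 ^ m))) ⟩
    + (2 ℕ.* 2 ^ m) * c                    ∎
    where
    open ≡-Reasoning

  ⟨_∙_⟩ : ∀ {m} → (Cube m → ℤ) → (Cube m → ℤ) → ℤ
  ⟨ h ∙ g ⟩ = ∑ (λ x → h x * g x)

  ⟨⟩-linear : ∀ {m} (h g k : Cube m → ℤ) a b →
    ⟨ h ∙ (λ x → a * g x - b * k x) ⟩ ≡ a * ⟨ h ∙ g ⟩ - b * ⟨ h ∙ k ⟩
  ⟨⟩-linear h g k a b = begin
    ∑ (λ x → h x * (a * g x - b * k x))
      ≡⟨ ∑-cong (λ x → expand (h x) a (g x) b (k x)) ⟩
    ∑ (λ x → a * (h x * g x) + (- b) * (h x * k x))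
      ≡⟨ ∑-+ (λ x → a * (h x * g x)) (λ x → (- b) * (h x * k x)) ⟩
    ∑ (λ x → a * (h x * g x)) + ∑ (λ x → (- b) * (h x * k x))
      ≡⟨ cong₂ _+_ (∑-* a (λ x → h x * g x)) (∑-* (- b) (λ x → h x * k x)) ⟩
    a * ⟨ h ∙ g ⟩ + (- b) * ⟨ h ∙ k ⟩
      ≡⟨ collect a b ⟨ h ∙ g ⟩ ⟨ h ∙ k ⟩ ⟩
    a * ⟨ h ∙ g ⟩ - b * ⟨ h ∙ k ⟩ ∎
    where
    open ≡-Reasoning
    expand : ∀ h a g b k → h * (a * g - b * k) ≡ a * (h * g) + (- b) * (h * k)
    expand = solve-∀
    collect : ∀ a b x y → a * x + (- b) * y ≡ a * x - b * y
    collect = solve-∀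

  -- The Walsh character of the set α, with the entry true of x standing for −1.
  χ : ∀ {m} → Cube m → Cube m → ℤ
  χ []          []          = 1ℤ
  χ (false ∷ α) (_ ∷ x)     = χ α x
  χ (true ∷ α)  (false ∷ x) = χ α x
  χ (true ∷ α)  (true ∷ x)  = - χ α x

  ⟨χ-true∙⟩ : ∀ {m} (α : Cube m) g →
    ⟨ χ (true ∷ α) ∙ g ⟩ ≡ ⟨ χ α ∙ g ∘ (false ∷_) ⟩ - ⟨ χ α ∙ g ∘ (true ∷_) ⟩
  ⟨χ-true∙⟩ α g = cong (_+_ ⟨ χ α ∙ g ∘ (false ∷_) ⟩)
    (trans (∑-cong (λ x → sym (ℤₚ.neg-distribˡ-* (χ α x) (g (true ∷ x))))) (∑-neg (λ x → χ α x * g (true ∷ x))))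

  2^suc : ∀ m → + (2 ^ suc m) ≡ + 2 * + (2 ^ m)
  2^suc m = ℤₚ.pos-* 2 (2 ^ m)

  -- Induction on the dimension: if `a` and `b` are the coefficients of the two halves of `g`, then
  -- those of `g` are `a + b` and `a - b`, and the parallelogram law applies.
  parseval : ∀ {m} (g : Cube m → ℤ) →
    ∑ (λ α → ⟨ χ α ∙ g ⟩ * ⟨ χ α ∙ g ⟩) ≡ + (2 ^ m) * ⟨ g ∙ g ⟩
  parseval {zero}  g = square (g [])
    where
    square : ∀ a → (1ℤ * a) * (1ℤ * a) ≡ 1ℤ * (a * a)
    square = solve-∀
  parseval {suc m} g = begin
    ∑ (λ α → (a α + b α) * (a α + b α)) + ∑ (λ α → ⟨ χ (true ∷ α) ∙ g ⟩ * ⟨ χ (true ∷ α) ∙ g ⟩)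
      ≡⟨ cong (_+_ (∑ (λ α → (a α + b α) * (a α + b α)))) (∑-cong (λ α → cong₂ _*_ (⟨χ-true∙⟩ α g) (⟨χ-true∙⟩ α g))) ⟩
    ∑ (λ α → (a α + b α) * (a α + b α)) + ∑ (λ α → (a α - b α) * (a α - b α))
      ≡⟨ sym (∑-+ (λ α → (a α + b α) * (a α + b α)) (λ α → (a α - b α) * (a α - b α))) ⟩
    ∑ (λ α → (a α + b α) * (a α + b α) + (a α - b α) * (a α - b α))
      ≡⟨ ∑-cong (λ α → parallelogram (a α) (b α)) ⟩
    ∑ (λ α → + 2 * (a α * a α + b α * b α))
      ≡⟨ trans (∑-* (+ 2) (λ α → a α * a α + b α * b α)) (cong (+ 2 *_) (∑-+ (λ α → a α * a α) (λ α → b α * b α))) ⟩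
    + 2 * (∑ (λ α → a α * a α) + ∑ (λ α → b α * b α))
      ≡⟨ cong (+ 2 *_) (cong₂ _+_ (parseval g₀) (parseval g₁)) ⟩
    + 2 * (+ (2 ^ m) * ⟨ g₀ ∙ g₀ ⟩ + + (2 ^ m) * ⟨ g₁ ∙ g₁ ⟩)
      ≡⟨ regroup (+ (2 ^ m)) ⟨ g₀ ∙ g₀ ⟩ ⟨ g₁ ∙ g₁ ⟩ ⟩
    (+ 2 * + (2 ^ m)) * (⟨ g₀ ∙ g₀ ⟩ + ⟨ g₁ ∙ g₁ ⟩)
      ≡⟨ cong (_* ⟨ g ∙ g ⟩) (sym (2^suc m)) ⟩
    + (2 ^ suc m) * ⟨ g ∙ g ⟩ ∎
    where
    open ≡-Reasoning
    g₀ = g ∘ (false ∷_)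
    g₁ = g ∘ (true ∷_)
    a = λ α → ⟨ χ α ∙ g₀ ⟩
    b = λ α → ⟨ χ α ∙ g₁ ⟩
    parallelogram : ∀ a b → (a + b) * (a + b) + (a - b) * (a - b) ≡ + 2 * (a * a + b * b)
    parallelogram = solve-∀
    regroup : ∀ p x y → + 2 * (p * x + p * y) ≡ (+ 2 * p) * (x + y)
    regroup = solve-∀

  +-double : ∀ a → a + a ≡ + 2 * a
  +-double = solve-∀

  neg*neg : ∀ a b → - a * - b ≡ a * b
  neg*neg = solve-∀

  χ-self : ∀ {m} (α : Cube m) → ⟨ χ α ∙ χ α ⟩ ≡ + (2 ^ m)
  χ-self []          = refl
  χ-self {suc m} (false ∷ α) = trans (cong₂ _+_ (χ-self α) (χ-self α)) (trans (+-double (+ (2 ^ m))) (sym (2^suc m)))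
  χ-self {suc m} (true ∷ α)  = trans
    (cong (_+_ ⟨ χ α ∙ χ α ⟩) (∑-cong (λ x → neg*neg (χ α x) (χ α x))))
    (trans (cong₂ _+_ (χ-self α) (χ-self α)) (trans (+-double (+ (2 ^ m))) (sym (2^suc m))))

  χ-orthogonal : ∀ {m} (α γ : Cube m) → α ≢ γ → ⟨ χ α ∙ χ γ ⟩ ≡ 0ℤ
  χ-orthogonal [] [] α≢γ = contradiction refl α≢γ
  χ-orthogonal (false ∷ α) (false ∷ γ) α≢γ =
    let e = χ-orthogonal α γ (α≢γ ∘ cong (false ∷_)) in cong₂ _+_ e e
  χ-orthogonal (true ∷ α) (true ∷ γ) α≢γ =
    let e = χ-orthogonal α γ (α≢γ ∘ cong (true ∷_)) in
    cong₂ _+_ e (trans (∑-cong (λ x → neg*neg (χ α x) (χ γ x))) e)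
  χ-orthogonal (false ∷ α) (true ∷ γ) _ = trans
    (cong (_+_ ⟨ χ α ∙ χ γ ⟩) (trans (∑-cong (λ x → sym (ℤₚ.neg-distribʳ-* (χ α x) (χ γ x)))) (∑-neg (λ x → χ α x * χ γ x))))
    (ℤₚ.+-inverseʳ ⟨ χ α ∙ χ γ ⟩)
  χ-orthogonal (true ∷ α) (false ∷ γ) _ = trans
    (⟨χ-true∙⟩ α (χ (false ∷ γ))) (ℤₚ.+-inverseʳ ⟨ χ α ∙ χ γ ⟩)

  IsSign⇒∣∣≡1 : ∀ {i} → IsSign i → ∣ i ∣ ≡ 1
  IsSign⇒∣∣≡1 (inj₁ refl) = refl
  IsSign⇒∣∣≡1 (inj₂ refl) = refl

  IsSign-neg : ∀ {i} → IsSign i → IsSign (- i)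
  IsSign-neg (inj₁ refl) = inj₂ refl
  IsSign-neg (inj₂ refl) = inj₁ refl

  IsSign-* : ∀ {i j} → IsSign i → IsSign j → IsSign (i * j)
  IsSign-* (inj₁ refl) (inj₁ refl) = inj₁ refl
  IsSign-* (inj₁ refl) (inj₂ refl) = inj₂ refl
  IsSign-* (inj₂ refl) (inj₁ refl) = inj₂ refl
  IsSign-* (inj₂ refl) (inj₂ refl) = inj₁ refl

  χ-sign : ∀ {m} (α x : Cube m) → IsSign (χ α x)
  χ-sign []          []          = inj₁ refl
  χ-sign (false ∷ α) (_ ∷ x)     = χ-sign α x
  χ-sign (true ∷ α)  (false ∷ x) = χ-sign α x
  χ-sign (true ∷ α)  (true ∷ x)  = IsSign-neg (χ-sign α x)

  i*i≡∣i∣*∣i∣ : ∀ i → i * i ≡ + (∣ i ∣ ℕ.* ∣ i ∣)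
  i*i≡∣i∣*∣i∣ (+ n)        = sym (ℤₚ.pos-* n n)
  i*i≡∣i∣*∣i∣ (ℤ.-[1+ n ]) = refl

  -- Integrality enters here: an integer is bounded in absolute value by its square.
  ∣⟨⟩∣≤⟨⟩ : ∀ {m} (h g : Cube m → ℤ) → (∀ x → IsSign (h x)) → + ∣ ⟨ h ∙ g ⟩ ∣ ℤ.≤ ⟨ g ∙ g ⟩
  ∣⟨⟩∣≤⟨⟩ {zero} h g sh
    rewrite ℤₚ.abs-* (h []) (g []) | IsSign⇒∣∣≡1 (sh []) | i*i≡∣i∣*∣i∣ (g []) =
    ℤ.+≤+ (subst (ℕ._≤ ∣ g [] ∣ ℕ.* ∣ g [] ∣) (sym (ℕₚ.+-identityʳ _)) (n≤n*n ∣ g [] ∣))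
    where
    n≤n*n : ∀ n → n ℕ.≤ n ℕ.* n
    n≤n*n zero    = ℕ.z≤n
    n≤n*n (suc n) = ℕₚ.m≤m*n (suc n) (suc n)
  ∣⟨⟩∣≤⟨⟩ {suc m} h g sh = ℤₚ.≤-trans
    (ℤ.+≤+ (ℤₚ.∣i+j∣≤∣i∣+∣j∣ ⟨ h ∘ (false ∷_) ∙ g ∘ (false ∷_) ⟩ ⟨ h ∘ (true ∷_) ∙ g ∘ (true ∷_) ⟩))
    (ℤₚ.+-mono-≤ (∣⟨⟩∣≤⟨⟩ (h ∘ (false ∷_)) (g ∘ (false ∷_)) (sh ∘ (false ∷_)))
                 (∣⟨⟩∣≤⟨⟩ (h ∘ (true ∷_)) (g ∘ (true ∷_)) (sh ∘ (true ∷_))))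

  -- By Parseval `⟨ g ∙ g ⟩` is the mean of the squared Walsh coefficients. With `B = 0` this turns
  -- vanishing coefficients into vanishing products; with `B = 1` it carries smallness from the
  -- characters over to every sign row.
  small-transform : ∀ {m} (h g : Cube m → ℤ) B → (∀ x → IsSign (h x)) →
    (∀ α → ∣ ⟨ χ α ∙ g ⟩ ∣ ℕ.* ∣ ⟨ χ α ∙ g ⟩ ∣ ℕ.≤ B) → ∣ ⟨ h ∙ g ⟩ ∣ ℕ.≤ B
  small-transform {m} h g B sh bound = ℤₚ.drop‿+≤+ (ℤₚ.≤-trans (∣⟨⟩∣≤⟨⟩ h g sh)
    (ℤₚ.*-cancelˡ-≤-pos ⟨ g ∙ g ⟩ (+ B) (+ (2 ^ m)) {{ℤ.positive (ℤ.+<+ (ℕₚ.m^n>0 2 m))}} (begin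
      + (2 ^ m) * ⟨ g ∙ g ⟩              ≡⟨ parseval g ⟨
      ∑ (λ α → ⟨ χ α ∙ g ⟩ * ⟨ χ α ∙ g ⟩)  ≤⟨ ∑-mono (λ α → subst (ℤ._≤ + B) (sym (i*i≡∣i∣*∣i∣ ⟨ χ α ∙ g ⟩)) (ℤ.+≤+ (bound α))) ⟩
      ∑ {m} (λ _ → + B)                    ≡⟨ ∑-const m (+ B) ⟩
      + (2 ^ m) * + B                    ∎)))
    where open ℤₚ.≤-Reasoning

  -- Binary counting through the large sets

  -- Binary order, the head being the most significant digit.
  data _≺_ : ∀ {m} → Cube m → Cube m → Set where
    here  : ∀ {m} {α β : Cube m} → (false ∷ α) ≺ (true ∷ β)
    there : ∀ {m b} {α β : Cube m} → α ≺ β → (b ∷ α) ≺ (b ∷ β)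

  ≺-irrefl : ∀ {m} {α : Cube m} → ¬ α ≺ α
  ≺-irrefl (there p) = ≺-irrefl p

  ≺-trans : ∀ {m} {α β γ : Cube m} → α ≺ β → β ≺ γ → α ≺ γ
  ≺-trans here      (there q) = here
  ≺-trans (there p) here      = here
  ≺-trans (there p) (there q) = there (≺-trans p q)

  ≺⇒≢ : ∀ {m} {α β : Cube m} → α ≺ β → α ≢ β
  ≺⇒≢ p refl = ≺-irrefl p

  ones zeros : ∀ m → Cube m
  ones  m = replicate m true
  zeros m = replicate m false

  ≼ones : ∀ {m} (γ : Cube m) → γ ≡ ones m ⊎ γ ≺ ones m
  ≼ones []          = inj₁ refl
  ≼ones (false ∷ γ) = inj₂ here
  ≼ones (true ∷ γ) with ≼ones γ
  ... | inj₁ refl = inj₁ refl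
  ... | inj₂ p    = inj₂ (there p)

  size : ∀ {m} → Cube m → ℕ
  size []          = 0
  size (false ∷ α) = size α
  size (true ∷ α)  = suc (size α)

  size≤ : ∀ {m} (α : Cube m) → size α ℕ.≤ m
  size≤ []          = ℕ.z≤n
  size≤ (false ∷ α) = ℕₚ.m≤n⇒m≤1+n (size≤ α)
  size≤ (true ∷ α)  = ℕ.s≤s (size≤ α)

  size-ones : ∀ m → size (ones m) ≡ m
  size-ones zero    = refl
  size-ones (suc m) = cong suc (size-ones m)

  size-zeros : ∀ m → size (zeros m) ≡ 0
  size-zeros zero    = refl
  size-zeros (suc m) = size-zeros m

  -- The ≺-least set with at least k elements.
  first : ℕ → ∀ m → Cube m
  first k zero = []
  first k (suc m) with k ℕ.≤? m
  ... | yes _ = false ∷ first k m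
  ... | no  _ = true ∷ first (pred k) m

  size-first : ∀ k m → k ℕ.≤ m → k ℕ.≤ size (first k m)
  size-first k zero    k≤m = k≤m
  size-first k (suc m) k≤m with k ℕ.≤? m
  ... | yes p = size-first k m p
  size-first zero    (suc m) k≤m         | no _ = ℕ.z≤n
  size-first (suc k) (suc m) (ℕ.s≤s k≤m) | no _ = ℕ.s≤s (size-first k m k≤m)

  pred≤ : ∀ {k n} → k ℕ.≤ suc n → pred k ℕ.≤ n
  pred≤ {zero}  _         = ℕ.z≤n
  pred≤ {suc k} (ℕ.s≤s p) = p

  ≤suc : ∀ {k n} → pred k ℕ.≤ n → k ℕ.≤ suc n
  ≤suc {zero}  _ = ℕ.z≤n
  ≤suc {suc k} p = ℕ.s≤s p

  first-least : ∀ k m (γ : Cube m) → γ ≺ first k m → ¬ k ℕ.≤ size γ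
  first-least k (suc m) γ p k≤ with k ℕ.≤? m
  first-least k (suc m) (false ∷ γ) (there p) k≤ | yes _ = first-least k m γ p k≤
  first-least k (suc m) (true ∷ γ)  (there p) k≤ | no _  = first-least (pred k) m γ p (pred≤ k≤)
  first-least k (suc m) (false ∷ γ) here      k≤ | no q  = q (ℕₚ.≤-trans k≤ (size≤ γ))

  -- Next k β α: the set α follows β in the ≺-order among the sets with at least k elements.
  data Next : ∀ {m} → ℕ → Cube m → Cube m → Set where
    out   : ∀ {m k} {β α : Cube m} → Next k β α → Next k (false ∷ β) (false ∷ α)
    within   : ∀ {m k} {β α : Cube m} → Next (pred k) β α → Next k (true ∷ β) (true ∷ α)
    carry : ∀ {m k} → k ℕ.≤ m → Next k (false ∷ ones m) (true ∷ first (pred k) m)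

  Next⇒≺ : ∀ {m k} {β α : Cube m} → Next k β α → β ≺ α
  Next⇒≺ (out s)   = there (Next⇒≺ s)
  Next⇒≺ (within s)   = there (Next⇒≺ s)
  Next⇒≺ (carry _) = here

  Next⇒size : ∀ {m k} {β α : Cube m} → Next k β α → k ℕ.≤ size β × k ℕ.≤ size α
  Next⇒size (out s) = Next⇒size s
  Next⇒size (within s) = let p , q = Next⇒size s in ≤suc p , ≤suc q
  Next⇒size {suc m} {k} (carry k≤m) =
    subst (k ℕ.≤_) (sym (size-ones m)) k≤m ,
    ≤suc (size-first (pred k) m (ℕₚ.≤-trans ℕₚ.pred[n]≤n k≤m))

  -- Ensures that the equation linking `β` and `α` involves nothing uncontrolled: any other set
  -- before `α` is either below the threshold or already before `β`.
  Next-gap : ∀ {m k} {β α : Cube m} → Next k β α →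
    ∀ γ → γ ≺ α → k ℕ.≤ size γ → γ ≡ β ⊎ γ ≺ β
  Next-gap (out s) (false ∷ γ) (there p) k≤ with Next-gap s γ p k≤
  ... | inj₁ refl = inj₁ refl
  ... | inj₂ q    = inj₂ (there q)
  Next-gap (within s) (false ∷ γ) here k≤ = inj₂ here
  Next-gap (within s) (true ∷ γ) (there p) k≤ with Next-gap s γ p (pred≤ k≤)
  ... | inj₁ refl = inj₁ refl
  ... | inj₂ q    = inj₂ (there q)
  Next-gap (carry _) (false ∷ γ) here k≤ with ≼ones γ
  ... | inj₁ refl = inj₁ refl
  ... | inj₂ q    = inj₂ (there q)
  Next-gap {suc m} {k} (carry _) (true ∷ γ) (there p) k≤ =
    contradiction (pred≤ k≤) (first-least (pred k) m γ p)

  Next-unique : ∀ {m k} {β β′ α : Cube m} → Next k β α → Next k β′ α → β ≡ β′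
  Next-unique s s′ with Next-gap s _ (Next⇒≺ s′) (proj₁ (Next⇒size s′))
                      | Next-gap s′ _ (Next⇒≺ s) (proj₁ (Next⇒size s))
  ... | inj₁ refl | _         = refl
  ... | inj₂ _    | inj₁ refl = refl
  ... | inj₂ p    | inj₂ q    = contradiction (≺-trans p q) ≺-irrefl

  _≟_ : ∀ {m} → DecidableEquality (Cube m)
  _≟_ = ≡-dec Boolₚ._≟_

  Next? : ∀ {m} k (α : Cube m) → Dec (∃ λ β → Next k β α)
  Next? k [] = no λ ()
  Next? k (false ∷ α) with Next? k α
  ... | yes (β , s) = yes (false ∷ β , out s)
  ... | no ¬s       = no λ { (_ , out s) → ¬s (_ , s) }
  Next? {suc m} k (true ∷ α) with Next? (pred k) α
  ... | yes (β , s) = yes (true ∷ β , within s)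
  ... | no ¬s with α ≟ first (pred k) m | k ℕ.≤? m
  ...   | yes refl | yes k≤m = yes (false ∷ ones m , carry k≤m)
  ...   | yes refl | no k≰m  = no λ { (_ , within s) → ¬s (_ , s) ; (_ , carry p) → k≰m p }
  ...   | no α≢    | _       = no λ { (_ , within s) → ¬s (_ , s) ; (_ , carry p) → α≢ refl }

  meet : ∀ {m} → Cube m → Cube m → ℕ
  meet []          []          = 0
  meet (true ∷ β)  (true ∷ α)  = suc (meet β α)
  meet (true ∷ β)  (false ∷ α) = meet β α
  meet (false ∷ β) (_ ∷ α)     = meet β α

  meet-comm : ∀ {m} (β α : Cube m) → meet β α ≡ meet α β
  meet-comm []          []          = refl
  meet-comm (true ∷ β)  (true ∷ α)  = cong suc (meet-comm β α)
  meet-comm (true ∷ β)  (false ∷ α) = meet-comm β α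
  meet-comm (false ∷ β) (true ∷ α)  = meet-comm β α
  meet-comm (false ∷ β) (false ∷ α) = meet-comm β α

  meet-ones : ∀ {m} (α : Cube m) → meet (ones m) α ≡ size α
  meet-ones []          = refl
  meet-ones (true ∷ α)  = cong suc (meet-ones α)
  meet-ones (false ∷ α) = meet-ones α

  -- At the carry the tail of `β` is full, so the only element of `α` missing from `β` is the digit
  -- that the carry switches on.
  Next⇒meet : ∀ {m k} {β α : Cube m} → Next k β α → suc (meet β α) ≡ size α
  Next⇒meet (out s)   = Next⇒meet s
  Next⇒meet (within s)   = cong suc (Next⇒meet s)
  Next⇒meet {suc m} {k} (carry _) = cong suc (meet-ones (first (pred k) m))

  -- climbExponent w k m: the sum of w + |α| ∸ 2 over all α ⊆ [m] that have a predecessor for Next k.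
  climbExponent : ℕ → ℕ → ℕ → ℕ
  climbExponent w k zero = 0
  climbExponent w k (suc m) with k ℕ.≤? m
  ... | yes _ = climbExponent w k m ℕ.+ (w ℕ.+ suc (size (first (pred k) m)) ∸ 2) ℕ.+ climbExponent (suc w) (pred k) m
  ... | no  _ = climbExponent (suc w) (pred k) m

  -- The head, once fixed, moves from the set into the weight, which turns `w` into `suc w`.
  within-step : ∀ {m} w k (P : Cube (suc m) → ℕ → Set) →
    (∀ {β α e} → Next k β α → P β e → P α (e ℕ.+ (w ℕ.+ size α ∸ 2))) →
    ∀ {β α e} → Next (pred k) β α → P (true ∷ β) e → P (true ∷ α) (e ℕ.+ (suc w ℕ.+ size α ∸ 2))
  within-step w k P step {β} {α} {e} s p =
    subst (λ x → P (true ∷ α) (e ℕ.+ (x ∸ 2))) (ℕₚ.+-suc w (size α)) (step (within s) p)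

  -- Induction along the chain of large sets: first those without the head, then one carry, then
  -- those with the head. It serves both the growth of the coefficients and the construction of a
  -- kernel vector.
  climb : ∀ w k m (P : Cube m → ℕ → Set) →
    (∀ {β α e} → Next k β α → P β e → P α (e ℕ.+ (w ℕ.+ size α ∸ 2))) →
    ∀ {e} → P (first k m) e → P (ones m) (e ℕ.+ climbExponent w k m)
  climb w k zero P step {e} p = subst (P []) (sym (ℕₚ.+-identityʳ e)) p
  climb w k (suc m) P step {e} p with k ℕ.≤? m
  ... | yes k≤m = subst (P (ones (suc m))) reassoc
    (climb (suc w) (pred k) m (P ∘ (true ∷_)) (within-step w k P step)
      (step (carry k≤m) (climb w k m (P ∘ (false ∷_)) (step ∘ out) p)))
    where
    E₁ = climbExponent w k m
    E₂ = climbExponent (suc w) (pred k) m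
    c  = w ℕ.+ suc (size (first (pred k) m)) ∸ 2
    reassoc : e ℕ.+ E₁ ℕ.+ c ℕ.+ E₂ ≡ e ℕ.+ (E₁ ℕ.+ c ℕ.+ E₂)
    reassoc = trans (cong (ℕ._+ E₂) (ℕₚ.+-assoc e E₁ c)) (ℕₚ.+-assoc e (E₁ ℕ.+ c) E₂)
  ... | no _ = climb (suc w) (pred k) m (P ∘ (true ∷_)) (within-step w k P step) p

  -- The doubled weights `w + |α|` of all subsets sum to `2 ^ m * (2 * w + m)`, and each set is
  -- allowed to lose 10. A linked set loses 4 through the truncation by 2; a set below the threshold
  -- has weight less than `w + k`, hence less than 5. The first large set, which has no predecessor,
  -- is charged `2 * (w + k)` in place of 10.
  climbExponent-bound : ∀ w k m → k ≡ 0 ⊎ w ℕ.+ k ℕ.≤ 5 →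
    2 ^ m ℕ.* (2 ℕ.* w ℕ.+ m) ℕ.+ 10 ℕ.≤ 2 ℕ.* climbExponent w k m ℕ.+ 2 ℕ.* (w ℕ.+ k) ℕ.+ 10 ℕ.* 2 ^ m
  climbExponent-bound w k zero _ = begin
    1 ℕ.* (2 ℕ.* w ℕ.+ 0) ℕ.+ 10   ≡⟨ simplify w ⟩
    2 ℕ.* w ℕ.+ 10                 ≤⟨ ℕₚ.+-monoˡ-≤ 10 (ℕₚ.*-monoʳ-≤ 2 (ℕₚ.m≤m+n w k)) ⟩
    2 ℕ.* (w ℕ.+ k) ℕ.+ 10         ∎
    where
    open ℕₚ.≤-Reasoning
    simplify : ∀ w → 1 ℕ.* (2 ℕ.* w ℕ.+ 0) ℕ.+ 10 ≡ 2 ℕ.* w ℕ.+ 10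
    simplify = ℕSolver.solve-∀
  climbExponent-bound w k (suc m) h with k ℕ.≤? m
  ... | yes k≤m = ℕₚ.+-cancelʳ-≤ 10 _ _ (begin
    2 ℕ.* N ℕ.* (2 ℕ.* w ℕ.+ suc m) ℕ.+ 10 ℕ.+ 10
      ≡⟨ split N w m ⟩
    (N ℕ.* (2 ℕ.* w ℕ.+ m) ℕ.+ 10) ℕ.+ (N ℕ.* (2 ℕ.* suc w ℕ.+ m) ℕ.+ 10)
      ≤⟨ ℕₚ.+-mono-≤ (climbExponent-bound w k m h) (climbExponent-bound (suc w) (pred k) m (next h)) ⟩
    (2 ℕ.* E₁ ℕ.+ 2 ℕ.* (w ℕ.+ k) ℕ.+ 10 ℕ.* N) ℕ.+ (2 ℕ.* E₂ ℕ.+ 2 ℕ.* (suc w ℕ.+ pred k) ℕ.+ 10 ℕ.* N)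
      ≤⟨ ℕₚ.+-monoʳ-≤ (2 ℕ.* E₁ ℕ.+ 2 ℕ.* (w ℕ.+ k) ℕ.+ 10 ℕ.* N)
           (ℕₚ.+-monoˡ-≤ (10 ℕ.* N) (ℕₚ.+-monoʳ-≤ (2 ℕ.* E₂) (ℕₚ.*-monoʳ-≤ 2 carry-weight))) ⟩
    (2 ℕ.* E₁ ℕ.+ 2 ℕ.* (w ℕ.+ k) ℕ.+ 10 ℕ.* N) ℕ.+ (2 ℕ.* E₂ ℕ.+ 2 ℕ.* (2 ℕ.+ c) ℕ.+ 10 ℕ.* N)
      -- The set reached by the carry is now linked and uses only 4 of its allowance of 10.
      ≤⟨ ℕₚ.m≤m+n _ 6 ⟩
    (2 ℕ.* E₁ ℕ.+ 2 ℕ.* (w ℕ.+ k) ℕ.+ 10 ℕ.* N) ℕ.+ (2 ℕ.* E₂ ℕ.+ 2 ℕ.* (2 ℕ.+ c) ℕ.+ 10 ℕ.* N) ℕ.+ 6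
      ≡⟨ gather E₁ E₂ c (w ℕ.+ k) N ⟩
    2 ℕ.* (E₁ ℕ.+ c ℕ.+ E₂) ℕ.+ 2 ℕ.* (w ℕ.+ k) ℕ.+ 10 ℕ.* (2 ℕ.* N) ℕ.+ 10 ∎)
    where
    open ℕₚ.≤-Reasoning
    N = 2 ^ m
    E₁ = climbExponent w k m
    E₂ = climbExponent (suc w) (pred k) m
    c  = w ℕ.+ suc (size (first (pred k) m)) ∸ 2
    next : ∀ {k} → k ≡ 0 ⊎ w ℕ.+ k ℕ.≤ 5 → pred k ≡ 0 ⊎ suc w ℕ.+ pred k ℕ.≤ 5
    next {zero}  _        = inj₁ refl
    next {suc k} (inj₂ p) = inj₂ (subst (ℕ._≤ 5) (ℕₚ.+-suc w k) p)
    carry-weight : suc w ℕ.+ pred k ℕ.≤ 2 ℕ.+ c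
    carry-weight = begin
      suc w ℕ.+ pred k                      ≤⟨ ℕₚ.+-monoʳ-≤ (suc w) (size-first (pred k) m (pred≤ {k} {m} (ℕₚ.m≤n⇒m≤1+n k≤m))) ⟩
      suc w ℕ.+ size (first (pred k) m)     ≡⟨ ℕₚ.+-suc w _ ⟨
      w ℕ.+ suc (size (first (pred k) m))   ≤⟨ ℕₚ.m≤n+m∸n _ 2 ⟩
      2 ℕ.+ c                               ∎
    split : ∀ N w m → 2 ℕ.* N ℕ.* (2 ℕ.* w ℕ.+ suc m) ℕ.+ 10 ℕ.+ 10 ≡
      (N ℕ.* (2 ℕ.* w ℕ.+ m) ℕ.+ 10) ℕ.+ (N ℕ.* (2 ℕ.* suc w ℕ.+ m) ℕ.+ 10)
    split = ℕSolver.solve-∀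
    gather : ∀ E₁ E₂ c s N →
      (2 ℕ.* E₁ ℕ.+ 2 ℕ.* s ℕ.+ 10 ℕ.* N) ℕ.+ (2 ℕ.* E₂ ℕ.+ 2 ℕ.* (2 ℕ.+ c) ℕ.+ 10 ℕ.* N) ℕ.+ 6 ≡
      2 ℕ.* (E₁ ℕ.+ c ℕ.+ E₂) ℕ.+ 2 ℕ.* s ℕ.+ 10 ℕ.* (2 ℕ.* N) ℕ.+ 10
    gather = ℕSolver.solve-∀
  climbExponent-bound w zero    (suc m) _        | no k≰m = contradiction ℕ.z≤n k≰m
  climbExponent-bound w (suc k) (suc m) (inj₂ p) | no k≰m = begin
    2 ℕ.* N ℕ.* (2 ℕ.* w ℕ.+ suc m) ℕ.+ 10
      ≡⟨ split N w m ⟩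
    (N ℕ.* (2 ℕ.* suc w ℕ.+ m) ℕ.+ 10) ℕ.+ N ℕ.* (2 ℕ.* w ℕ.+ m)
      ≤⟨ ℕₚ.+-mono-≤ (climbExponent-bound (suc w) k m (inj₂ (subst (ℕ._≤ 5) (ℕₚ.+-suc w k) p))) (ℕₚ.*-monoʳ-≤ N 2w+m≤10) ⟩
    (2 ℕ.* E₂ ℕ.+ 2 ℕ.* (suc w ℕ.+ k) ℕ.+ 10 ℕ.* N) ℕ.+ N ℕ.* 10
      ≡⟨ gather E₂ w k N ⟩
    2 ℕ.* E₂ ℕ.+ 2 ℕ.* (w ℕ.+ suc k) ℕ.+ 10 ℕ.* (2 ℕ.* N) ∎
    where
    open ℕₚ.≤-Reasoning
    N = 2 ^ m
    E₂ = climbExponent (suc w) k m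
    -- All sets without the head are below the threshold here; their mean doubled weight `2 * w + m`
    -- has to fit into the allowance.
    2w+m≤10 : 2 ℕ.* w ℕ.+ m ℕ.≤ 10
    2w+m≤10 = begin
      2 ℕ.* w ℕ.+ m            ≤⟨ ℕₚ.+-monoʳ-≤ (2 ℕ.* w) (ℕₚ.≤-trans (ℕₚ.<⇒≤ (ℕₚ.≰⇒> k≰m)) (ℕₚ.m≤n*m (suc k) 2)) ⟩
      2 ℕ.* w ℕ.+ 2 ℕ.* suc k  ≡⟨ ℕₚ.*-distribˡ-+ 2 w (suc k) ⟨
      2 ℕ.* (w ℕ.+ suc k)      ≤⟨ ℕₚ.*-monoʳ-≤ 2 p ⟩
      10                       ∎
    split : ∀ N w m → 2 ℕ.* N ℕ.* (2 ℕ.* w ℕ.+ suc m) ℕ.+ 10 ≡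
      (N ℕ.* (2 ℕ.* suc w ℕ.+ m) ℕ.+ 10) ℕ.+ N ℕ.* (2 ℕ.* w ℕ.+ m)
    split = ℕSolver.solve-∀
    gather : ∀ E₂ w k N →
      (2 ℕ.* E₂ ℕ.+ 2 ℕ.* (suc w ℕ.+ k) ℕ.+ 10 ℕ.* N) ℕ.+ N ℕ.* 10 ≡
      2 ℕ.* E₂ ℕ.+ 2 ℕ.* (w ℕ.+ suc k) ℕ.+ 10 ℕ.* (2 ℕ.* N)
    gather = ℕSolver.solve-∀

  -- The linking rows and their kernel

  clear : ∀ {m} → Cube m → Cube m → Cube m → Bool
  clear []      []      []      = true
  clear (b ∷ β) (a ∷ α) (x ∷ y) = not (b ∧ a ∧ x) ∧ clear β α y

  clear-comm : ∀ {m} (β α x : Cube m) → clear β α x ≡ clear α β x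
  clear-comm []          []          []          = refl
  clear-comm (false ∷ β) (false ∷ α) (_ ∷ x)     = clear-comm β α x
  clear-comm (false ∷ β) (true ∷ α)  (_ ∷ x)     = clear-comm β α x
  clear-comm (true ∷ β)  (false ∷ α) (_ ∷ x)     = clear-comm β α x
  clear-comm (true ∷ β)  (true ∷ α)  (false ∷ x) = clear-comm β α x
  clear-comm (true ∷ β)  (true ∷ α)  (true ∷ x)  = refl

  -- Up to the factor 2^|α ∩ β|, this row has coefficient 1 at χ α, coefficient 2^|α ∩ β| − 1 at χ β,
  -- and otherwise only coefficients ±1 at proper subsets of α or β.
  linkRow : ∀ {m} → Cube m → Cube m → Cube m → ℤ
  linkRow β α x = if clear β α x then χ α x else χ β x

  -- The sum of h over the sets α ∖ δ with δ ⊆ α ∩ β.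
  down : ∀ {m} → Cube m → Cube m → (Cube m → ℤ) → ℤ
  down []          []          h = h []
  down (true ∷ β)  (true ∷ α)  h = down β α (h ∘ (true ∷_)) + down β α (h ∘ (false ∷_))
  down (true ∷ β)  (false ∷ α) h = down β α (h ∘ (false ∷_))
  down (false ∷ β) (a ∷ α)     h = down β α (h ∘ (a ∷_))

  down-neg : ∀ {m} (β α : Cube m) h → down β α (λ γ → - h γ) ≡ - down β α h
  down-neg []          []          h = refl
  down-neg (true ∷ β)  (true ∷ α)  h =
    trans (cong₂ _+_ (down-neg β α (h ∘ (true ∷_))) (down-neg β α (h ∘ (false ∷_))))
          (sym (ℤₚ.neg-distrib-+ (down β α (h ∘ (true ∷_))) (down β α (h ∘ (false ∷_)))))
  down-neg (true ∷ β)  (false ∷ α) h = down-neg β α (h ∘ (false ∷_))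
  down-neg (false ∷ β) (a ∷ α)     h = down-neg β α (h ∘ (a ∷_))

  down-∑ : ∀ {m n} (β α : Cube m) (h : Cube m → Cube n → ℤ) g →
    ⟨ (λ x → down β α (λ γ → h γ x)) ∙ g ⟩ ≡ down β α (λ γ → ⟨ h γ ∙ g ⟩)
  down-∑ []          []          h g = refl
  down-∑ (true ∷ β)  (true ∷ α)  h g = begin
    ∑ (λ x → (down β α (λ γ → h (true ∷ γ) x) + down β α (λ γ → h (false ∷ γ) x)) * g x)
      ≡⟨ ∑-cong (λ x → ℤₚ.*-distribʳ-+ (g x) (down β α (λ γ → h (true ∷ γ) x)) (down β α (λ γ → h (false ∷ γ) x))) ⟩
    ∑ (λ x → down β α (λ γ → h (true ∷ γ) x) * g x + down β α (λ γ → h (false ∷ γ) x) * g x)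
      ≡⟨ ∑-+ (λ x → down β α (λ γ → h (true ∷ γ) x) * g x) (λ x → down β α (λ γ → h (false ∷ γ) x) * g x) ⟩
    ⟨ (λ x → down β α (λ γ → h (true ∷ γ) x)) ∙ g ⟩ + ⟨ (λ x → down β α (λ γ → h (false ∷ γ) x)) ∙ g ⟩
      ≡⟨ cong₂ _+_ (down-∑ β α (h ∘ (true ∷_)) g) (down-∑ β α (h ∘ (false ∷_)) g) ⟩
    down β α (λ γ → ⟨ h (true ∷ γ) ∙ g ⟩) + down β α (λ γ → ⟨ h (false ∷ γ) ∙ g ⟩) ∎
    where open ≡-Reasoning
  down-∑ (true ∷ β)  (false ∷ α) h g = down-∑ β α (h ∘ (false ∷_)) g
  down-∑ (false ∷ β) (a ∷ α)     h g = down-∑ β α (h ∘ (a ∷_)) g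

  -- The sum factors as `χ α x` times the product of `1 + χ` of the singleton `i` at `x`, over the
  -- elements `i` of α ∩ β. Each factor is 2 or 0, and all are 2 exactly when `x` vanishes on α ∩ β.
  down-χ : ∀ {m} (β α x : Cube m) →
    down β α (λ γ → χ γ x) ≡ + (2 ^ meet β α) * (if clear β α x then χ α x else 0ℤ)
  down-χ []          []          []          = refl
  down-χ (true ∷ β)  (true ∷ α)  (false ∷ x) =
    trans (cong₂ _+_ (down-χ β α x) (down-χ β α x))
          (trans (*-double (+ (2 ^ meet β α)) _) (cong (_* (if clear β α x then χ α x else 0ℤ)) (sym (2^suc (meet β α)))))
  down-χ (true ∷ β)  (true ∷ α)  (true ∷ x)  =
    trans (cong (_+ down β α (λ γ → χ γ x)) (down-neg β α (λ γ → χ γ x)))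
          (trans (ℤₚ.+-inverseˡ (down β α (λ γ → χ γ x))) (sym (ℤₚ.*-zeroʳ (+ (2 ^ suc (meet β α))))))
  down-χ (true ∷ β)  (false ∷ α) (_ ∷ x)     = down-χ β α x
  down-χ (false ∷ β) (false ∷ α) (_ ∷ x)     = down-χ β α x
  down-χ (false ∷ β) (true ∷ α)  (false ∷ x) = down-χ β α x
  down-χ (false ∷ β) (true ∷ α)  (true ∷ x)  =
    trans (down-neg β α (λ γ → χ γ x)) (trans (cong -_ (down-χ β α x))
      (trans (ℤₚ.neg-distribʳ-* (+ (2 ^ meet β α)) _) (cong (+ (2 ^ meet β α) *_) (neg-if (clear β α x)))))
    where
    neg-if : ∀ b → - (if b then χ α x else 0ℤ) ≡ (if b then - χ α x else 0ℤ)
    neg-if true  = refl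
    neg-if false = refl

  -- The row is `χ β` plus the indicator of `clear β α` times `χ α - χ β`; after scaling, `down-χ`
  -- expands the two products with the indicator.
  linkRow-expansion : ∀ {m} (β α : Cube m) g →
    + (2 ^ meet β α) * ⟨ linkRow β α ∙ g ⟩ ≡
    + (2 ^ meet β α) * ⟨ χ β ∙ g ⟩ + (down β α (λ γ → ⟨ χ γ ∙ g ⟩) - down α β (λ γ → ⟨ χ γ ∙ g ⟩))
  linkRow-expansion {m} β α g = begin
    p * ⟨ linkRow β α ∙ g ⟩
      ≡⟨ ∑-* p (λ x → linkRow β α x * g x) ⟨
    ∑ (λ x → p * (linkRow β α x * g x))
      ≡⟨ ∑-cong pointwise ⟩
    ∑ (λ x → p * (χ β x * g x) + (Dα x * g x + - (Dβ x * g x)))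
      ≡⟨ ∑-+ (λ x → p * (χ β x * g x)) (λ x → Dα x * g x + - (Dβ x * g x)) ⟩
    ∑ (λ x → p * (χ β x * g x)) + ∑ (λ x → Dα x * g x + - (Dβ x * g x))
      ≡⟨ cong₂ _+_ (∑-* p (λ x → χ β x * g x))
           (trans (∑-+ (λ x → Dα x * g x) (λ x → - (Dβ x * g x))) (cong (_+_ ⟨ Dα ∙ g ⟩) (∑-neg (λ x → Dβ x * g x)))) ⟩
    p * ⟨ χ β ∙ g ⟩ + (⟨ Dα ∙ g ⟩ - ⟨ Dβ ∙ g ⟩)
      ≡⟨ cong (_+_ (p * ⟨ χ β ∙ g ⟩)) (cong₂ _-_ (down-∑ β α χ g) (down-∑ α β χ g)) ⟩
    p * ⟨ χ β ∙ g ⟩ + (down β α (λ γ → ⟨ χ γ ∙ g ⟩) - down α β (λ γ → ⟨ χ γ ∙ g ⟩)) ∎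
    where
    open ≡-Reasoning
    p = + (2 ^ meet β α)
    Dα Dβ : Cube m → ℤ
    Dα x = down β α (λ γ → χ γ x)
    Dβ x = down α β (λ γ → χ γ x)
    select : ∀ b p u v c → p * ((if b then u else v) * c) ≡
      p * (v * c) + ((p * (if b then u else 0ℤ)) * c + - ((p * (if b then v else 0ℤ)) * c))
    select true  = select-true
      where
      select-true : ∀ p u v c → p * (u * c) ≡ p * (v * c) + ((p * u) * c + - ((p * v) * c))
      select-true = solve-∀
    select false = λ p u v c → select-false p v c
      where
      select-false : ∀ p v c → p * (v * c) ≡ p * (v * c) + ((p * 0ℤ) * c + - ((p * 0ℤ) * c))
      select-false = solve-∀
    Dβ≡ : ∀ x → Dβ x ≡ p * (if clear β α x then χ β x else 0ℤ)
    Dβ≡ x = trans (down-χ α β x) (cong₂ (λ k b → + (2 ^ k) * (if b then χ β x else 0ℤ)) (meet-comm α β) (clear-comm α β x))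
    pointwise : ∀ x → p * (linkRow β α x * g x) ≡ p * (χ β x * g x) + (Dα x * g x + - (Dβ x * g x))
    pointwise x = trans (select (clear β α x) p (χ α x) (χ β x) (g x))
      (cong (_+_ (p * (χ β x * g x))) (cong₂ (λ u v → u * g x + - (v * g x)) (sym (down-χ β α x)) (sym (Dβ≡ x))))

  linkRow-sign : ∀ {m} (β α x : Cube m) → IsSign (linkRow β α x)
  linkRow-sign β α x with clear β α x
  ... | true  = χ-sign α x
  ... | false = χ-sign β x

  *∣+∣≤ : ∀ c i j {a b} → c ℕ.* ∣ i ∣ ℕ.≤ a → c ℕ.* ∣ j ∣ ℕ.≤ b → c ℕ.* ∣ i + j ∣ ℕ.≤ a ℕ.+ b
  *∣+∣≤ c i j p q = ℕₚ.≤-trans (ℕₚ.*-monoʳ-≤ c (ℤₚ.∣i+j∣≤∣i∣+∣j∣ i j))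
    (ℕₚ.≤-trans (ℕₚ.≤-reflexive (ℕₚ.*-distribˡ-+ c ∣ i ∣ ∣ j ∣)) (ℕₚ.+-mono-≤ p q))

  ℕ-*-double : ∀ P B → P ℕ.* B ℕ.+ P ℕ.* B ≡ 2 ℕ.* P ℕ.* B
  ℕ-*-double = ℕSolver.solve-∀

  down-bound : ∀ {m} c B (β α : Cube m) h → (∀ γ → c ℕ.* ∣ h γ ∣ ℕ.≤ B) →
    c ℕ.* ∣ down β α h ∣ ℕ.≤ 2 ^ meet β α ℕ.* B
  down-bound c B []          []          h p = ℕₚ.≤-trans (p []) (ℕₚ.≤-reflexive (sym (ℕₚ.*-identityˡ B)))
  down-bound c B (true ∷ β)  (true ∷ α)  h p = ℕₚ.≤-trans
    (*∣+∣≤ c (down β α (h ∘ (true ∷_))) (down β α (h ∘ (false ∷_)))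
      (down-bound c B β α (h ∘ (true ∷_)) (p ∘ (true ∷_))) (down-bound c B β α (h ∘ (false ∷_)) (p ∘ (false ∷_))))
    (ℕₚ.≤-reflexive (ℕ-*-double (2 ^ meet β α) B))
  down-bound c B (true ∷ β)  (false ∷ α) h p = down-bound c B β α (h ∘ (false ∷_)) (p ∘ (false ∷_))
  down-bound c B (false ∷ β) (a ∷ α)     h p = down-bound c B β α (h ∘ (a ∷_)) (p ∘ (a ∷_))

  -- Removing the term `h α` leaves one summand fewer than `2 ^ meet β α`, whence the spare `B` on
  -- the left. The other sets arise from `α` by deleting a nonempty part of α ∩ β, so they precede
  -- `α` and differ from `β`.
  down-remainder : ∀ {m} c B (β α : Cube m) h →
    (∀ γ → γ ≺ α → γ ≢ β → c ℕ.* ∣ h γ ∣ ℕ.≤ B) →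
    c ℕ.* ∣ down β α h - h α ∣ ℕ.+ B ℕ.≤ 2 ^ meet β α ℕ.* B
  down-remainder c B [] [] h p = ℕₚ.≤-reflexive (begin
    c ℕ.* ∣ h [] - h [] ∣ ℕ.+ B ≡⟨ cong (λ i → c ℕ.* ∣ i ∣ ℕ.+ B) (ℤₚ.+-inverseʳ (h [])) ⟩
    c ℕ.* 0 ℕ.+ B               ≡⟨ cong (ℕ._+ B) (ℕₚ.*-zeroʳ c) ⟩
    B                           ≡⟨ ℕₚ.*-identityˡ B ⟨
    1 ℕ.* B                     ∎)
    where open ≡-Reasoning
  down-remainder c B (true ∷ β) (true ∷ α) h p = begin
    c ℕ.* ∣ d₁ + d₀ - hα ∣ ℕ.+ B                 ≡⟨ cong (λ i → c ℕ.* ∣ i ∣ ℕ.+ B) (swap d₁ d₀ hα) ⟩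
    c ℕ.* ∣ d₀ + (d₁ - hα) ∣ ℕ.+ B               ≤⟨ ℕₚ.+-monoˡ-≤ B (*∣+∣≤ c d₀ (d₁ - hα)
                                                     (down-bound c B β α (h ∘ (false ∷_)) (λ γ → p (false ∷ γ) here λ ()))
                                                     ℕₚ.≤-refl) ⟩
    P ℕ.* B ℕ.+ c ℕ.* ∣ d₁ - hα ∣ ℕ.+ B          ≡⟨ ℕₚ.+-assoc (P ℕ.* B) _ B ⟩
    P ℕ.* B ℕ.+ (c ℕ.* ∣ d₁ - hα ∣ ℕ.+ B)        ≤⟨ ℕₚ.+-monoʳ-≤ (P ℕ.* B) (down-remainder c B β α (h ∘ (true ∷_))
                                                     (λ γ γ≺α γ≢β → p (true ∷ γ) (there γ≺α) (γ≢β ∘ ∷-injectiveʳ))) ⟩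
    P ℕ.* B ℕ.+ P ℕ.* B                          ≡⟨ ℕ-*-double P B ⟩
    2 ℕ.* P ℕ.* B                                ∎
    where
    open ℕₚ.≤-Reasoning
    P  = 2 ^ meet β α
    d₁ = down β α (h ∘ (true ∷_))
    d₀ = down β α (h ∘ (false ∷_))
    hα = h (true ∷ α)
    swap : ∀ a b c → a + b - c ≡ b + (a - c)
    swap = solve-∀
  down-remainder c B (true ∷ β)  (false ∷ α) h p =
    down-remainder c B β α (h ∘ (false ∷_)) (λ γ γ≺α _ → p (false ∷ γ) (there γ≺α) λ ())
  down-remainder c B (false ∷ β) (false ∷ α) h p =
    down-remainder c B β α (h ∘ (false ∷_)) (λ γ γ≺α γ≢β → p (false ∷ γ) (there γ≺α) (γ≢β ∘ ∷-injectiveʳ))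
  down-remainder c B (false ∷ β) (true ∷ α)  h p =
    down-remainder c B β α (h ∘ (true ∷_)) (λ γ γ≺α _ → p (true ∷ γ) (there γ≺α) λ ())

  -- The Håstad-type matrix.  The two rows without a link, for |α| < 5 and for the first large set,
  -- annihilate the small coefficients and repeat one of them respectively.
  row : ∀ {m} → Cube m → Cube m → ℤ
  row α with size α ℕ.<? 5
  ... | yes _ = χ α
  ... | no  _ with Next? 5 α
  ...   | yes (β , _) = linkRow β α
  ...   | no  _       = χ (zeros _)

  row-sign : ∀ {m} (α x : Cube m) → IsSign (row α x)
  row-sign α x with size α ℕ.<? 5
  ... | yes _ = χ-sign α x
  ... | no  _ with Next? 5 α
  ...   | yes (β , _) = linkRow-sign β α x
  ...   | no  _       = χ-sign (zeros _) x

  Kernel : ∀ {m} → (Cube m → ℤ) → Set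
  Kernel {m} g = (∀ (γ : Cube m) → size γ ℕ.< 5 → ⟨ χ γ ∙ g ⟩ ≡ 0ℤ)
               × (∀ (β α : Cube m) → Next 5 β α → ⟨ linkRow β α ∙ g ⟩ ≡ 0ℤ)

  rows⇒Kernel : ∀ {m} (g : Cube m → ℤ) → (∀ α → ⟨ row α ∙ g ⟩ ≡ 0ℤ) → Kernel g
  rows⇒Kernel {m} g zero-rows = small , linked
    where
    small : ∀ (γ : Cube m) → size γ ℕ.< 5 → ⟨ χ γ ∙ g ⟩ ≡ 0ℤ
    small γ γ<5 with size γ ℕ.<? 5 | zero-rows γ
    ... | yes _   | e = e
    ... | no γ≮5  | _ = contradiction γ<5 γ≮5
    linked : ∀ (β α : Cube m) → Next 5 β α → ⟨ linkRow β α ∙ g ⟩ ≡ 0ℤ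
    linked β α s with size α ℕ.<? 5 | zero-rows α
    ... | yes α<5 | _ = contradiction (proj₂ (Next⇒size s)) (ℕₚ.<⇒≱ α<5)
    ... | no _    | e with Next? 5 α
    ...   | yes (β′ , s′) = subst (λ β → ⟨ linkRow β α ∙ g ⟩ ≡ 0ℤ) (Next-unique s′ s) e
    ...   | no ¬s         = contradiction (β , s) ¬s

  Kernel⇒rows : ∀ {m} (g : Cube m → ℤ) → Kernel g → ∀ α → ⟨ row α ∙ g ⟩ ≡ 0ℤ
  Kernel⇒rows {m} g (small , linked) α with size α ℕ.<? 5
  ... | yes α<5 = small α α<5
  ... | no  _ with Next? 5 α
  ...   | yes (β , s) = linked β α s
  ...   | no  _       = small (zeros m) (subst (ℕ._< 5) (sym (size-zeros m)) (ℕ.s≤s ℕ.z≤n))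

  -- Growth of the Fourier coefficients along the chain

  -- The invariant of the climb: `dominates` controls the remainders in the next equation,
  -- `lower-bound` accumulates the gain, and `vanishes` ties every coefficient on the chain to the
  -- first one.
  record Grown {m} (g : Cube m → ℤ) (α : Cube m) (e : ℕ) : Set where
    field
      dominates   : ∀ γ → γ ≺ α → 8 ℕ.* ∣ ⟨ χ γ ∙ g ⟩ ∣ ℕ.≤ ∣ ⟨ χ α ∙ g ⟩ ∣
      lower-bound : 2 ^ e ℕ.* ∣ ⟨ χ (first 5 m) ∙ g ⟩ ∣ ℕ.≤ ∣ ⟨ χ α ∙ g ⟩ ∣
      vanishes    : ⟨ χ (first 5 m) ∙ g ⟩ ≡ 0ℤ → ⟨ χ α ∙ g ⟩ ≡ 0ℤ

  -- The link equation reads `P * z β ≡ z β + Rβ - Rα - z α`. Each remainder collects at most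
  -- `P - 1` coefficients of modulus at most `b / 8`, so `a` is at least `3 / 4` of `(P - 1) * b`,
  -- and this is at least `P * b / 2` because `P` is at least 3.
  grow : ∀ {m} (g : Cube m → ℤ) → Kernel g → ∀ {β α e} → Next 5 β α →
    Grown g β e → Grown g α (e ℕ.+ (size α ∸ 2))
  grow {m} g (small , linked) {β} {α} {e} s grown = record
    { dominates   = dominates′
    ; lower-bound = lower-bound′
    ; vanishes    = vanishes′
    }
    where
    open Grown grown
    z : Cube m → ℤ
    z γ = ⟨ χ γ ∙ g ⟩
    P a b rα rβ t : ℕ
    P = 2 ^ meet β α
    a = ∣ z α ∣
    b = ∣ z β ∣
    Rα Rβ : ℤ
    Rα = down β α z - z α
    Rβ = down α β z - z β
    rα = ∣ Rα ∣
    rβ = ∣ Rβ ∣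
    t = size α ∸ 2

    equation : + P * z β ≡ z β + Rβ - Rα - z α
    equation = begin
      + P * z β                                                  ≡⟨ isolate (+ P * z β) (down β α z) (down α β z) ⟩
      (+ P * z β + (down β α z - down α β z)) + (down α β z - down β α z)
        ≡⟨ cong (_+ (down α β z - down β α z)) (sym (linkRow-expansion β α g)) ⟩
      + P * ⟨ linkRow β α ∙ g ⟩ + (down α β z - down β α z)
        ≡⟨ cong (λ i → + P * i + (down α β z - down β α z)) (linked β α s) ⟩
      + P * 0ℤ + (down α β z - down β α z)                       ≡⟨ rearrange (+ P) (down β α z) (down α β z) (z α) (z β) ⟩
      z β + Rβ - Rα - z α                                        ∎
      where
      open ≡-Reasoning
      isolate : ∀ x d e → x ≡ (x + (d - e)) + (e - d)
      isolate = solve-∀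
      rearrange : ∀ p d e zα zβ → p * 0ℤ + (e - d) ≡ zβ + (e - zβ) - (d - zα) - zα
      rearrange = solve-∀

    below : ∀ γ → γ ≺ α → γ ≢ β → 8 ℕ.* ∣ z γ ∣ ℕ.≤ b
    below γ γ≺α γ≢β with 5 ℕ.≤? size γ
    ... | no γ≱5 = subst (λ i → 8 ℕ.* ∣ i ∣ ℕ.≤ b) (sym (small γ (ℕₚ.≰⇒> γ≱5))) ℕ.z≤n
    ... | yes γ≥5 with Next-gap s γ γ≺α γ≥5
    ...   | inj₁ γ≡β = contradiction γ≡β γ≢β
    ...   | inj₂ γ≺β = dominates γ γ≺β

    rα-bound : 8 ℕ.* rα ℕ.+ b ℕ.≤ P ℕ.* b
    rα-bound = down-remainder 8 b β α z below
    rβ-bound : 8 ℕ.* rβ ℕ.+ b ℕ.≤ P ℕ.* b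
    rβ-bound = subst (λ k → 8 ℕ.* rβ ℕ.+ b ℕ.≤ 2 ^ k ℕ.* b) (meet-comm α β)
      (down-remainder 8 b α β z (λ γ γ≺β _ → dominates γ γ≺β))

    size≡ : size α ≡ 2 ℕ.+ t
    size≡ = sym (ℕₚ.m+[n∸m]≡n (ℕₚ.≤-trans (ℕₚ.m≤n+m 2 3) (proj₂ (Next⇒size s))))
    P≡ : P ≡ 2 ℕ.* 2 ^ t
    P≡ = cong (2 ^_) (ℕₚ.suc-injective (trans (Next⇒meet s) size≡))
    -- The threshold five makes every gain at least 8, which restores the factor 8 of `dominates` at
    -- `α`.
    8≤2^t : 8 ℕ.≤ 2 ^ t
    8≤2^t = ℕₚ.^-monoʳ-≤ 2 {3} {t} (ℕₚ.+-cancelˡ-≤ 2 3 t (subst (5 ℕ.≤_) size≡ (proj₂ (Next⇒size s))))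
    3≤P : 3 ℕ.≤ P
    3≤P = subst (3 ℕ.≤_) (sym P≡) (ℕₚ.≤-trans (ℕₚ.m≤n+m 3 13) (ℕₚ.*-monoʳ-≤ 2 8≤2^t))

    triangle : P ℕ.* b ℕ.≤ b ℕ.+ rβ ℕ.+ rα ℕ.+ a
    triangle = begin
      P ℕ.* b                          ≡⟨ ℤₚ.abs-* (+ P) (z β) ⟨
      ∣ + P * z β ∣                    ≡⟨ cong ∣_∣ equation ⟩
      ∣ z β + Rβ - Rα - z α ∣          ≤⟨ ℤₚ.∣i-j∣≤∣i∣+∣j∣ (z β + Rβ - Rα) (z α) ⟩
      ∣ z β + Rβ - Rα ∣ ℕ.+ a          ≤⟨ ℕₚ.+-monoˡ-≤ a (ℤₚ.∣i-j∣≤∣i∣+∣j∣ (z β + Rβ) Rα) ⟩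
      ∣ z β + Rβ ∣ ℕ.+ rα ℕ.+ a        ≤⟨ ℕₚ.+-monoˡ-≤ a (ℕₚ.+-monoˡ-≤ rα (ℤₚ.∣i+j∣≤∣i∣+∣j∣ (z β) Rβ)) ⟩
      b ℕ.+ rβ ℕ.+ rα ℕ.+ a            ∎
      where open ℕₚ.≤-Reasoning

    gain : P ℕ.* b ℕ.≤ 2 ℕ.* a
    gain = ℕₚ.*-cancelˡ-≤ 4 (ℕₚ.+-cancelʳ-≤ (4 ℕ.* (P ℕ.* b) ℕ.+ 2 ℕ.* b) _ _ (begin
      4 ℕ.* (P ℕ.* b) ℕ.+ (4 ℕ.* (P ℕ.* b) ℕ.+ 2 ℕ.* b)
        ≡⟨ arrange₁ (P ℕ.* b) b ⟩
      8 ℕ.* (P ℕ.* b) ℕ.+ 2 ℕ.* b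
        ≤⟨ ℕₚ.+-monoˡ-≤ (2 ℕ.* b) (ℕₚ.*-monoʳ-≤ 8 triangle) ⟩
      8 ℕ.* (b ℕ.+ rβ ℕ.+ rα ℕ.+ a) ℕ.+ 2 ℕ.* b
        ≡⟨ arrange₂ a b rα rβ ⟩
      8 ℕ.* a ℕ.+ 2 ℕ.* (3 ℕ.* b) ℕ.+ ((8 ℕ.* rα ℕ.+ b) ℕ.+ (8 ℕ.* rβ ℕ.+ b)) ℕ.+ 2 ℕ.* b
        ≤⟨ ℕₚ.+-monoˡ-≤ (2 ℕ.* b) (ℕₚ.+-mono-≤
             (ℕₚ.+-monoʳ-≤ (8 ℕ.* a) (ℕₚ.*-monoʳ-≤ 2 (ℕₚ.*-monoˡ-≤ b 3≤P))) (ℕₚ.+-mono-≤ rα-bound rβ-bound)) ⟩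
      8 ℕ.* a ℕ.+ 2 ℕ.* (P ℕ.* b) ℕ.+ (P ℕ.* b ℕ.+ P ℕ.* b) ℕ.+ 2 ℕ.* b
        ≡⟨ arrange₃ a (P ℕ.* b) b ⟩
      4 ℕ.* (2 ℕ.* a) ℕ.+ (4 ℕ.* (P ℕ.* b) ℕ.+ 2 ℕ.* b) ∎))
      where
      open ℕₚ.≤-Reasoning
      arrange₁ : ∀ p b → 4 ℕ.* p ℕ.+ (4 ℕ.* p ℕ.+ 2 ℕ.* b) ≡ 8 ℕ.* p ℕ.+ 2 ℕ.* b
      arrange₁ = ℕSolver.solve-∀
      arrange₂ : ∀ a b r s → 8 ℕ.* (b ℕ.+ s ℕ.+ r ℕ.+ a) ℕ.+ 2 ℕ.* b ≡
        8 ℕ.* a ℕ.+ 2 ℕ.* (3 ℕ.* b) ℕ.+ ((8 ℕ.* r ℕ.+ b) ℕ.+ (8 ℕ.* s ℕ.+ b)) ℕ.+ 2 ℕ.* b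
      arrange₂ = ℕSolver.solve-∀
      arrange₃ : ∀ a p b → 8 ℕ.* a ℕ.+ 2 ℕ.* p ℕ.+ (p ℕ.+ p) ℕ.+ 2 ℕ.* b ≡ 4 ℕ.* (2 ℕ.* a) ℕ.+ (4 ℕ.* p ℕ.+ 2 ℕ.* b)
      arrange₃ = ℕSolver.solve-∀

    2^t*b≤a : 2 ^ t ℕ.* b ℕ.≤ a
    2^t*b≤a = ℕₚ.*-cancelˡ-≤ 2 (subst (ℕ._≤ 2 ℕ.* a) (trans (cong (ℕ._* b) P≡) (ℕₚ.*-assoc 2 (2 ^ t) b)) gain)

    8b≤a : 8 ℕ.* b ℕ.≤ a
    8b≤a = ℕₚ.≤-trans (ℕₚ.*-monoˡ-≤ b 8≤2^t) 2^t*b≤a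

    dominates′ : ∀ γ → γ ≺ α → 8 ℕ.* ∣ z γ ∣ ℕ.≤ a
    dominates′ γ γ≺α with γ ≟ β
    ... | yes refl = 8b≤a
    ... | no γ≢β   = ℕₚ.≤-trans (below γ γ≺α γ≢β) (ℕₚ.≤-trans (ℕₚ.m≤n*m b 8) 8b≤a)

    lower-bound′ : 2 ^ (e ℕ.+ t) ℕ.* ∣ z (first 5 m) ∣ ℕ.≤ a
    lower-bound′ = begin
      2 ^ (e ℕ.+ t) ℕ.* f          ≡⟨ cong (ℕ._* f) (trans (ℕₚ.^-distribˡ-+-* 2 e t) (ℕₚ.*-comm (2 ^ e) (2 ^ t))) ⟩
      2 ^ t ℕ.* 2 ^ e ℕ.* f      ≡⟨ ℕₚ.*-assoc (2 ^ t) (2 ^ e) f ⟩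
      2 ^ t ℕ.* (2 ^ e ℕ.* f)    ≤⟨ ℕₚ.*-monoʳ-≤ (2 ^ t) lower-bound ⟩
      2 ^ t ℕ.* b                  ≤⟨ 2^t*b≤a ⟩
      a                              ∎
      where
      open ℕₚ.≤-Reasoning
      f = ∣ z (first 5 m) ∣

    vanishes′ : z (first 5 m) ≡ 0ℤ → z α ≡ 0ℤ
    vanishes′ e₀ = begin
      z α                                 ≡⟨ isolate (z α) (z β) Rα Rβ ⟩
      z β + Rβ - Rα - (z β + Rβ - Rα - z α) ≡⟨ cong₂ _-_ (cong₂ _-_ (cong₂ _+_ zβ≡0 (zero-remainder rβ-bound)) (zero-remainder rα-bound)) (sym equation) ⟩
      0ℤ - + P * z β                      ≡⟨ cong (λ i → 0ℤ - + P * i) zβ≡0 ⟩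
      0ℤ - + P * 0ℤ                       ≡⟨ cong (_-_ 0ℤ) (ℤₚ.*-zeroʳ (+ P)) ⟩
      0ℤ                                  ∎
      where
      open ≡-Reasoning
      isolate : ∀ a b r s → a ≡ b + s - r - (b + s - r - a)
      isolate = solve-∀
      zβ≡0 : z β ≡ 0ℤ
      zβ≡0 = vanishes e₀
      -- Since `z β` vanishes, `b` is zero and the remainder bounds leave no room.
      zero-remainder : ∀ {i} → 8 ℕ.* ∣ i ∣ ℕ.+ b ℕ.≤ P ℕ.* b → i ≡ 0ℤ
      zero-remainder {i} p = ℤₚ.∣i∣≡0⇒i≡0 (ℕₚ.n≤0⇒n≡0 (ℕₚ.≤-trans (ℕₚ.m≤n*m ∣ i ∣ 8)
        (ℕₚ.≤-trans (ℕₚ.m≤m+n (8 ℕ.* ∣ i ∣) b)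
          (subst (8 ℕ.* ∣ i ∣ ℕ.+ b ℕ.≤_) (trans (cong (λ j → P ℕ.* ∣ j ∣) zβ≡0) (ℕₚ.*-zeroʳ P)) p))))

  -- The sign vector `h` witnesses that `g` is nonzero. If the first large coefficient were zero,
  -- all coefficients would be, and `small-transform` with `B = 0` would give `⟨ h ∙ g ⟩ ≡ 0ℤ`. So
  -- that coefficient has modulus at least 1, and the climb to the full set multiplies it.
  kernel-large : ∀ {m} (h g : Cube m → ℤ) → (∀ x → IsSign (h x)) → Kernel g → ⟨ h ∙ g ⟩ ≢ 0ℤ →
    2 ^ climbExponent 0 5 m ℕ.≤ ∣ ⟨ χ (ones m) ∙ g ⟩ ∣
  kernel-large {m} h g sh ker ⟨h∙g⟩≢0 = ℕₚ.≤-trans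
    (ℕₚ.m≤m*n _ ∣ z (first 5 m) ∣ {{ℕ.≢-nonZero (first≢0 ∘ ℤₚ.∣i∣≡0⇒i≡0)}}) lower-bound
    where
    z : Cube m → ℤ
    z γ = ⟨ χ γ ∙ g ⟩
    start : Grown g (first 5 m) 0
    start = record
      { dominates   = λ γ γ≺ → subst (λ i → 8 ℕ.* ∣ i ∣ ℕ.≤ ∣ z (first 5 m) ∣)
          (sym (proj₁ ker γ (ℕₚ.≰⇒> (first-least 5 m γ γ≺)))) ℕ.z≤n
      ; lower-bound = ℕₚ.≤-reflexive (ℕₚ.*-identityˡ _)
      ; vanishes    = id
      }
    open Grown (climb 0 5 m (Grown g) (grow g ker) start)
    first≢0 : z (first 5 m) ≢ 0ℤ
    first≢0 e = ⟨h∙g⟩≢0 (ℤₚ.∣i∣≡0⇒i≡0 (ℕₚ.n≤0⇒n≡0 (small-transform h g 0 sh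
      (λ γ → ℕₚ.≤-reflexive (cong (λ i → ∣ i ∣ ℕ.* ∣ i ∣) (z≡0 γ))))))
      where
      z≡0 : ∀ γ → z γ ≡ 0ℤ
      z≡0 γ with ≼ones γ
      ... | inj₁ refl = vanishes e
      ... | inj₂ γ≺   = ℤₚ.∣i∣≡0⇒i≡0 (ℕₚ.n≤0⇒n≡0 (ℕₚ.≤-trans (ℕₚ.m≤n*m ∣ z γ ∣ 8)
        (subst (λ i → 8 ℕ.* ∣ z γ ∣ ℕ.≤ ∣ i ∣) (vanishes e) (dominates γ γ≺))))

  -- Triangularity and existence of a kernel vector

  -- Every character of the expansion other than `χ α` comes before `α`, hence is orthogonal to
  -- `χ γ`. So a linking row has a nonzero entry at `α` and zeros at all later sets.
  linkRow-triangular : ∀ {m} {β α γ : Cube m} → β ≺ α → γ ≡ α ⊎ α ≺ γ →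
    + (2 ^ meet β α) * ⟨ linkRow β α ∙ χ γ ⟩ ≡ ⟨ χ α ∙ χ γ ⟩
  linkRow-triangular {m} {β} {α} {γ} β≺α α≼γ = begin
    p * ⟨ linkRow β α ∙ χ γ ⟩                        ≡⟨ linkRow-expansion β α (χ γ) ⟩
    p * z β + (down β α z - down α β z)              ≡⟨ cong₂ (λ i j → p * z β + (i - j)) (no-remainder β α (λ δ → orth δ))
                                                         (no-remainder α β (λ δ δ≺β → orth δ (≺-trans δ≺β β≺α))) ⟩
    p * z β + (z α - z β)                            ≡⟨ cong (λ i → p * i + (z α - i)) (orth β β≺α) ⟩
    p * 0ℤ + (z α - 0ℤ)                              ≡⟨ simplify p (z α) ⟩
    z α                                              ∎
    where
    open ≡-Reasoning
    p = + (2 ^ meet β α)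
    z : Cube m → ℤ
    z δ = ⟨ χ δ ∙ χ γ ⟩
    simplify : ∀ p a → p * 0ℤ + (a - 0ℤ) ≡ a
    simplify = solve-∀
    ≺γ : ∀ {δ} → δ ≺ α → γ ≡ α ⊎ α ≺ γ → δ ≺ γ
    ≺γ δ≺α (inj₁ refl) = δ≺α
    ≺γ δ≺α (inj₂ α≺γ)  = ≺-trans δ≺α α≺γ
    orth : ∀ δ → δ ≺ α → z δ ≡ 0ℤ
    orth δ δ≺α = χ-orthogonal δ γ (≺⇒≢ (≺γ δ≺α α≼γ))
    no-remainder : ∀ β α → (∀ δ → δ ≺ α → z δ ≡ 0ℤ) → down β α z ≡ z α
    -- The remainder bound with `B = 0` acts as an equation.
    no-remainder β α zero-below = ℤₚ.i-j≡0⇒i≡j (down β α z) (z α) (ℤₚ.∣i∣≡0⇒i≡0 (ℕₚ.n≤0⇒n≡0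
      (ℕₚ.≤-trans (ℕₚ.≤-trans (ℕₚ.m≤n*m ∣ down β α z - z α ∣ 1) (ℕₚ.m≤m+n (1 ℕ.* ∣ down β α z - z α ∣) 0))
      (ℕₚ.≤-trans (down-remainder 1 0 β α z (λ δ δ≺α _ → ℕₚ.≤-reflexive (cong (λ i → 1 ℕ.* ∣ i ∣) (zero-below δ δ≺α))))
      (ℕₚ.≤-reflexive (ℕₚ.*-zeroʳ (2 ^ meet β α)))))))

  -- Triangularity lets one kernel vector be built equation by equation, without pivoting: the equation of α
  -- is repaired by a multiple of χ α, which the earlier equations do not see.
  kernel-exists : ∀ m → 5 ℕ.≤ m → ∃ λ (g : Cube m → ℤ) → Kernel g × ⟨ χ (first 5 m) ∙ g ⟩ ≢ 0ℤ
  kernel-exists m 5≤m =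
    let g , ≢0 , small , linked = climb 0 5 m Solves (λ {_} {_} {e} → repair {e = e}) {0} start
    in g , (small , λ β α s → linked β α s (≼ones α)) , ≢0
    where
    f₀ : Cube m
    f₀ = first 5 m
    Solves : Cube m → ℕ → Set
    Solves α _ = ∃ λ g → ⟨ χ f₀ ∙ g ⟩ ≢ 0ℤ
      × (∀ γ → size γ ℕ.< 5 → ⟨ χ γ ∙ g ⟩ ≡ 0ℤ)
      × (∀ β′ α′ → Next 5 β′ α′ → α′ ≡ α ⊎ α′ ≺ α → ⟨ linkRow β′ α′ ∙ g ⟩ ≡ 0ℤ)
    2^m≢0 : + (2 ^ m) ≢ 0ℤ
    2^m≢0 e = contradiction (ℕₚ.m^n≡0⇒m≡0 2 m (ℤₚ.+-injective e)) λ ()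
    above-first : ∀ {β α} → Next 5 β α → f₀ ≢ α
    above-first {β} s refl = first-least 5 m β (Next⇒≺ s) (proj₁ (Next⇒size s))
    start : Solves f₀ 0
    start = χ f₀
      , 2^m≢0 ∘ trans (sym (χ-self f₀))
      , (λ γ γ<5 → χ-orthogonal γ f₀ λ { refl → ℕₚ.<⇒≱ γ<5 (size-first 5 m 5≤m) })
      , λ { β′ α′ s (inj₁ α′≡f₀) → contradiction (sym α′≡f₀) (above-first s)
          ; β′ α′ s (inj₂ α′≺f₀) → contradiction (proj₂ (Next⇒size s)) (first-least 5 m α′ α′≺f₀) }
    repair : ∀ {β α e} → Next 5 β α → Solves β e → Solves α (e ℕ.+ (size α ∸ 2))
    repair {β} {α} s (g , ≢0 , small , linked) = g′ , ≢0′ , small′ , linked′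
      where
      a b : ℤ
      a = ⟨ linkRow β α ∙ χ α ⟩
      b = ⟨ linkRow β α ∙ g ⟩
      -- Cross-multiplication avoids division: the product of the new equation with `g′` is
      -- `a * b - b * a`.
      g′ : Cube m → ℤ
      g′ x = a * g x - b * χ α x
      a≢0 : a ≢ 0ℤ
      a≢0 a≡0 = 2^m≢0 (begin
        + (2 ^ m)                  ≡⟨ χ-self α ⟨
        ⟨ χ α ∙ χ α ⟩                ≡⟨ linkRow-triangular (Next⇒≺ s) (inj₁ refl) ⟨
        + (2 ^ meet β α) * a       ≡⟨ cong (+ (2 ^ meet β α) *_) a≡0 ⟩
        + (2 ^ meet β α) * 0ℤ      ≡⟨ ℤₚ.*-zeroʳ (+ (2 ^ meet β α)) ⟩
        0ℤ                           ∎)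
        where open ≡-Reasoning
      unseen : ∀ h → ⟨ h ∙ χ α ⟩ ≡ 0ℤ → ⟨ h ∙ g′ ⟩ ≡ a * ⟨ h ∙ g ⟩
      unseen h e = trans (⟨⟩-linear h g (χ α) a b) (trans (cong (λ i → a * ⟨ h ∙ g ⟩ - b * i) e) (drop a ⟨ h ∙ g ⟩ b))
        where
        drop : ∀ a x b → a * x - b * 0ℤ ≡ a * x
        drop = solve-∀
      still-zero : ∀ h → ⟨ h ∙ χ α ⟩ ≡ 0ℤ → ⟨ h ∙ g ⟩ ≡ 0ℤ → ⟨ h ∙ g′ ⟩ ≡ 0ℤ
      still-zero h e e′ = trans (unseen h e) (trans (cong (a *_) e′) (ℤₚ.*-zeroʳ a))
      ≢0′ : ⟨ χ f₀ ∙ g′ ⟩ ≢ 0ℤ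
      ≢0′ e with ℤₚ.i*j≡0⇒i≡0∨j≡0 a (trans (sym (unseen (χ f₀) (χ-orthogonal f₀ α (above-first s)))) e)
      ... | inj₁ a≡0 = a≢0 a≡0
      ... | inj₂ p   = ≢0 p
      small′ : ∀ γ → size γ ℕ.< 5 → ⟨ χ γ ∙ g′ ⟩ ≡ 0ℤ
      small′ γ γ<5 = still-zero (χ γ)
        (χ-orthogonal γ α λ { refl → ℕₚ.<⇒≱ γ<5 (proj₂ (Next⇒size s)) }) (small γ γ<5)
      linked′ : ∀ β′ α′ → Next 5 β′ α′ → α′ ≡ α ⊎ α′ ≺ α → ⟨ linkRow β′ α′ ∙ g′ ⟩ ≡ 0ℤ
      linked′ β′ α′ s′ (inj₁ refl) with Next-unique s s′
      ... | refl = trans (⟨⟩-linear (linkRow β α) g (χ α) a b) (cancel a b)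
        where
        cancel : ∀ a b → a * b - b * a ≡ 0ℤ
        cancel = solve-∀
      linked′ β′ α′ s′ (inj₂ α′≺α) = still-zero (linkRow β′ α′)
        (zero-product (meet β′ α′) (trans (linkRow-triangular (Next⇒≺ s′) (inj₂ α′≺α)) (χ-orthogonal α′ α (≺⇒≢ α′≺α))))
        (linked β′ α′ s′ (Next-gap s α′ α′≺α (proj₂ (Next⇒size s′))))
        where
        zero-product : ∀ k {i} → + (2 ^ k) * i ≡ 0ℤ → i ≡ 0ℤ
        zero-product k e with ℤₚ.i*j≡0⇒i≡0∨j≡0 (+ (2 ^ k)) e
        ... | inj₁ p = contradiction (ℕₚ.m^n≡0⇒m≡0 2 k (ℤₚ.+-injective p)) λ ()
        ... | inj₂ p = p

  -- Collections of sign vectors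

  tot : ∀ {A : Set} → (A → ℤ) → List A → ℤ
  tot c []       = 0ℤ
  tot c (p ∷ ps) = c p + tot c ps

  tot-++ : ∀ {A : Set} (c : A → ℤ) ps qs → tot c (ps ++ qs) ≡ tot c ps + tot c qs
  tot-++ c []       qs = sym (ℤₚ.+-identityˡ _)
  tot-++ c (p ∷ ps) qs = trans (cong (_+_ (c p)) (tot-++ c ps qs)) (sym (ℤₚ.+-assoc (c p) _ _))

  ∣tot∣≤length : ∀ {A : Set} (c : A → ℤ) → (∀ p → IsSign (c p)) → ∀ ps → ∣ tot c ps ∣ ℕ.≤ length ps
  ∣tot∣≤length c sc []       = ℕ.z≤n
  ∣tot∣≤length c sc (p ∷ ps) = ℕₚ.≤-trans (ℤₚ.∣i+j∣≤∣i∣+∣j∣ (c p) (tot c ps))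
    (ℕₚ.+-mono-≤ (ℕₚ.≤-reflexive (IsSign⇒∣∣≡1 (sc p))) (∣tot∣≤length c sc ps))

  tot-1 : ∀ {A : Set} (c : A → ℤ) → (∀ p → c p ≡ 1ℤ) → ∀ ps → tot c ps ≡ + length ps
  tot-1 c e []       = refl
  tot-1 c e (p ∷ ps) = cong₂ _+_ (e p) (tot-1 c e ps)

  tot-parity : ∀ {A : Set} (c : A → ℤ) → (∀ p → IsSign (c p)) → ∀ ps →
    ∃ λ i → tot c ps ≡ + length ps + + 2 * i
  tot-parity c sc []       = 0ℤ , refl
  tot-parity c sc (p ∷ ps) with sc p | tot-parity c sc ps
  ... | inj₁ e | i , eq = i , trans (cong₂ _+_ e eq) (step⁺ (+ length ps) i)
    where
    step⁺ : ∀ n i → 1ℤ + (n + + 2 * i) ≡ (1ℤ + n) + + 2 * i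
    step⁺ = solve-∀
  ... | inj₂ e | i , eq = i - 1ℤ , trans (cong₂ _+_ e eq) (step⁻ (+ length ps) i)
    where
    step⁻ : ∀ n i → -1ℤ + (n + + 2 * i) ≡ (1ℤ + n) + + 2 * (i - 1ℤ)
    step⁻ = solve-∀

  Small : ℤ → Set
  Small i = ∣ i ∣ ℕ.≤ 1

  Small⇒box : ∀ {i} → Small i → -1ℤ ℤ.≤ i × i ℤ.≤ 1ℤ
  Small⇒box {+ n}          p          = ℤ.-≤+ , ℤ.+≤+ p
  Small⇒box {ℤ.-[1+ suc n ]} (ℕ.s≤s ())
  Small⇒box {ℤ.-[1+ zero ]}  p         = ℤ.-≤- ℕ.z≤n , ℤ.-≤+

  box⇒Small : ∀ {i} → -1ℤ ℤ.≤ i × i ℤ.≤ 1ℤ → Small i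
  box⇒Small {+ n}       (_ , ℤ.+≤+ p)  = p
  box⇒Small {ℤ.-[1+ n ]} (ℤ.-≤- p , _) = ℕ.s≤s p

  module _ {I : Set} {d : ℕ} (col : I → Fin d → ℤ) where

    family : (w : List I) → Family d (length w)
    family w i = col (List.lookup w i)

    Boxed : List I → Set
    Boxed w = ∀ j → Small (tot (λ p → col p j) w)

    totalSum-family : ∀ w j → totalSum (family w) j ≡ tot (λ p → col p j) w
    totalSum-family []      j = refl
    totalSum-family (p ∷ w) j = cong (_+_ (col p j)) (totalSum-family w j)

    select : (w : List I) → Subset (length w) → List I
    select []      []          = []
    select (p ∷ w) (true ∷ S)  = p ∷ select w S
    select (p ∷ w) (false ∷ S) = select w S

    length-select : ∀ w S → length (select w S) ≡ Subset.∣ S ∣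
    length-select []      []          = refl
    length-select (p ∷ w) (true ∷ S)  = cong suc (length-select w S)
    length-select (p ∷ w) (false ∷ S) = length-select w S

    subsetSum-family : ∀ w S j → subsetSum (family w) S j ≡ tot (λ p → col p j) (select w S)
    subsetSum-family []      []          j = refl
    subsetSum-family (p ∷ w) (true ∷ S)  j = cong (_+_ (col p j)) (subsetSum-family w S j)
    subsetSum-family (p ∷ w) (false ∷ S) j = trans (ℤₚ.+-identityˡ _) (subsetSum-family w S j)

    -- A subset violating condition (ii) is itself a shorter boxed collection with at least two
    -- members, so the search descends; `n` bounds the length for termination. The result keeps its
    -- box condition so that size bounds for boxed collections apply to it.
    minimal-collection : (∀ p j → IsSign (col p j)) → ∀ n w → length w ℕ.≤ n → 2 ℕ.≤ length w → Boxed w →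
      ∃ λ w′ → 2 ℕ.≤ length w′ × Boxed w′ × Valid d (length w′) (family w′)
    minimal-collection sc zero w w≤n 2≤w _ = contradiction (ℕₚ.≤-trans 2≤w w≤n) λ ()
    minimal-collection sc (suc n) w w≤n 2≤w boxed
      with anySubset? {P = λ S → 2 ℕ.≤ Subset.∣ S ∣ × Subset.∣ S ∣ ℕ.< length w × InBox (subsetSum (family w) S)}
             (λ S → 2 ℕ.≤? _ ×-dec (_ ℕ.<? _ ×-dec
               Finₚ.all? (λ j → -1ℤ ℤₚ.≤? subsetSum (family w) S j ×-dec subsetSum (family w) S j ℤₚ.≤? 1ℤ)))
    ... | yes (S , 2≤S , S<w , box) = minimal-collection sc n (select w S)
      (ℕₚ.≤-pred (ℕₚ.≤-trans (subst (ℕ._< length w) (sym (length-select w S)) S<w) w≤n))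
      (subst (2 ℕ.≤_) (sym (length-select w S)) 2≤S)
      (λ j → subst Small (subsetSum-family w S j) (box⇒Small (box j)))
    ... | no ¬S = w , 2≤w , boxed ,
      (λ i j → sc (List.lookup w i) j) ,
      (λ j → Small⇒box (subst Small (sym (totalSum-family w j)) (boxed j))) ,
      λ S 2≤S S<w box → ¬S (S , 2≤S , S<w , box)

  -- Multiplicity vectors and the two blocks of coordinates

  δ : ∀ {m} → Cube m → Cube m → ℤ
  δ []          []          = 1ℤ
  δ (false ∷ p) (false ∷ x) = δ p x
  δ (true ∷ p)  (true ∷ x)  = δ p x
  δ (false ∷ p) (true ∷ x)  = 0ℤ
  δ (true ∷ p)  (false ∷ x) = 0ℤ

  ∑-*0 : ∀ {m} (h : Cube m → ℤ) → ∑ (λ x → h x * 0ℤ) ≡ 0ℤ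
  ∑-*0 {m} h = trans (∑-cong (λ x → ℤₚ.*-zeroʳ (h x))) (trans (∑-const m 0ℤ) (ℤₚ.*-zeroʳ (+ (2 ^ m))))

  ⟨⟩-δ : ∀ {m} (h : Cube m → ℤ) p → ⟨ h ∙ δ p ⟩ ≡ h p
  ⟨⟩-δ h []          = ℤₚ.*-identityʳ (h [])
  ⟨⟩-δ h (false ∷ p) = trans (cong₂ _+_ (⟨⟩-δ (h ∘ (false ∷_)) p) (∑-*0 (h ∘ (true ∷_)))) (ℤₚ.+-identityʳ _)
  ⟨⟩-δ h (true ∷ p)  = trans (cong₂ _+_ (∑-*0 (h ∘ (false ∷_))) (⟨⟩-δ (h ∘ (true ∷_)) p)) (ℤₚ.+-identityˡ _)

  count : ∀ {m} → List (Cube m) → Cube m → ℤ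
  count []       x = 0ℤ
  count (p ∷ ps) x = δ p x + count ps x

  ⟨⟩-count : ∀ {m} (h : Cube m → ℤ) ps → ⟨ h ∙ count ps ⟩ ≡ tot h ps
  ⟨⟩-count h []       = ∑-*0 h
  ⟨⟩-count h (p ∷ ps) = begin
    ∑ (λ x → h x * (δ p x + count ps x))       ≡⟨ ∑-cong (λ x → ℤₚ.*-distribˡ-+ (h x) (δ p x) (count ps x)) ⟩
    ∑ (λ x → h x * δ p x + h x * count ps x)   ≡⟨ ∑-+ (λ x → h x * δ p x) (λ x → h x * count ps x) ⟩
    ⟨ h ∙ δ p ⟩ + ⟨ h ∙ count ps ⟩             ≡⟨ cong₂ _+_ (⟨⟩-δ h p) (⟨⟩-count h ps) ⟩
    h p + tot h ps                             ∎
    where open ≡-Reasoning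

  collect : ∀ {A : Set} {m} → (Cube m → ℕ) → (Cube m → A) → List A
  collect {m = zero}  y inj = List.replicate (y []) (inj [])
  collect {m = suc m} y inj = collect (y ∘ (false ∷_)) (inj ∘ (false ∷_)) ++ collect (y ∘ (true ∷_)) (inj ∘ (true ∷_))

  tot-replicate : ∀ {A : Set} (c : A → ℤ) n p → tot c (List.replicate n p) ≡ c p * + n
  tot-replicate c zero    p = sym (ℤₚ.*-zeroʳ (c p))
  tot-replicate c (suc n) p = trans (cong (_+_ (c p)) (tot-replicate c n p)) (sym (ℤₚ.*-suc (c p) (+ n)))

  tot-collect : ∀ {A : Set} {m} (c : A → ℤ) y (inj : Cube m → A) →
    tot c (collect y inj) ≡ ⟨ c ∘ inj ∙ (λ x → + y x) ⟩
  tot-collect {m = zero}  c y inj = tot-replicate c (y []) (inj [])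
  tot-collect {m = suc m} c y inj = trans
    (tot-++ c (collect (y ∘ (false ∷_)) (inj ∘ (false ∷_))) (collect (y ∘ (true ∷_)) (inj ∘ (true ∷_))))
    (cong₂ _+_ (tot-collect c (y ∘ (false ∷_)) (inj ∘ (false ∷_))) (tot-collect c (y ∘ (true ∷_)) (inj ∘ (true ∷_))))

  sgn : Bool → ℤ
  sgn true  = 1ℤ
  sgn false = -1ℤ

  sgn-sign : ∀ b → IsSign (sgn b)
  sgn-sign true  = inj₁ refl
  sgn-sign false = inj₂ refl

  -- The sign `b` flips only the Sylvester block. Hence the first block sees the difference of the
  -- two multiplicity vectors and the second block their sum.
  column : ∀ {m} → (Cube m → ℤ) → Bool × Cube m → Cube (suc m) → ℤ
  column ε (b , x) (false ∷ α) = sgn b * χ α x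
  column ε (b , x) (true ∷ α)  = ε x * row α x

  column-sign : ∀ {m} (ε : Cube m → ℤ) → (∀ x → IsSign (ε x)) → ∀ p α → IsSign (column ε p α)
  column-sign ε sε (b , x) (false ∷ α) = IsSign-* (sgn-sign b) (χ-sign α x)
  column-sign ε sε (b , x) (true ∷ α)  = IsSign-* (sε x) (row-sign α x)

  signed : ∀ {m} → Bool → List (Bool × Cube m) → List (Cube m)
  signed b     []                = []
  signed true  ((true , x) ∷ w)  = x ∷ signed true w
  signed true  ((false , x) ∷ w) = signed true w
  signed false ((true , x) ∷ w)  = signed false w
  signed false ((false , x) ∷ w) = x ∷ signed false w

  tot-signed : ∀ {m} (c : Bool × Cube m → ℤ) w →
    tot c w ≡ tot (λ x → c (true , x)) (signed true w) + tot (λ x → c (false , x)) (signed false w)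
  tot-signed c []                = refl
  tot-signed c ((true , x) ∷ w)  = trans (cong (_+_ (c (true , x))) (tot-signed c w)) (sym (ℤₚ.+-assoc (c (true , x)) _ _))
  tot-signed c ((false , x) ∷ w) = trans (cong (_+_ (c (false , x))) (tot-signed c w)) (rotate (c (false , x))
    (tot (λ x → c (true , x)) (signed true w)) (tot (λ x → c (false , x)) (signed false w)))
    where
    rotate : ∀ a b c → a + (b + c) ≡ b + (a + c)
    rotate = solve-∀

  length-signed : ∀ {m} (w : List (Bool × Cube m)) → length w ≡ length (signed true w) ℕ.+ length (signed false w)
  length-signed []                = refl
  length-signed ((true , x) ∷ w)  = cong suc (length-signed w)
  length-signed ((false , x) ∷ w) = trans (cong suc (length-signed w)) (sym (ℕₚ.+-suc _ _))

  tot-neg : ∀ {A : Set} (c : A → ℤ) ps → tot (λ p → -1ℤ * c p) ps ≡ - tot c ps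
  tot-neg c []       = refl
  tot-neg c (p ∷ ps) = trans (cong (_+_ (-1ℤ * c p)) (tot-neg c ps)) (factor (c p) (tot c ps))
    where
    factor : ∀ a b → -1ℤ * a + - b ≡ - (a + b)
    factor = solve-∀

  tot-cong : ∀ {A : Set} {c c′ : A → ℤ} → (∀ p → c p ≡ c′ p) → ∀ ps → tot c ps ≡ tot c′ ps
  tot-cong e []       = refl
  tot-cong e (p ∷ ps) = cong₂ _+_ (e p) (tot-cong e ps)

  Small-double : ∀ i → ∣ + 2 * i ∣ ℕ.≤ 2 → Small i
  Small-double i p = ℕₚ.*-cancelˡ-≤ 2 (subst (ℕ._≤ 2) (ℤₚ.abs-* (+ 2) i) p)

  Small-even : ∀ {k} i → k ≡ + 2 * i → Small k → k ≡ 0ℤ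
  Small-even i refl p = cong (+ 2 *_) (ℤₚ.∣i∣≡0⇒i≡0 (double≤1 ∣ i ∣ (subst (ℕ._≤ 1) (ℤₚ.abs-* (+ 2) i) p)))
    where
    double≤1 : ∀ n → 2 ℕ.* n ℕ.≤ 1 → n ≡ 0
    double≤1 zero    _ = refl
    double≤1 (suc n) q = contradiction (subst (ℕ._≤ 0) (ℕₚ.+-suc n (n ℕ.+ 0)) (ℕₚ.≤-pred q)) λ ()

  even∨odd : ∀ n → ∃ λ i → + n ≡ + 2 * i ⊎ + n ≡ 1ℤ + + 2 * i
  even∨odd zero = 0ℤ , inj₁ refl
  even∨odd (suc n) with even∨odd n
  ... | i , inj₁ e = i , inj₂ (cong (_+_ 1ℤ) e)
  ... | i , inj₂ e = i + 1ℤ , inj₁ (trans (cong (_+_ 1ℤ) e) (next i))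
    where
    next : ∀ i → 1ℤ + (1ℤ + + 2 * i) ≡ + 2 * (i + 1ℤ)
    next = solve-∀

  half-sum : ∀ X Y → + 2 * X ≡ (X + Y) + (X - Y)
  half-sum = solve-∀

  Small-half-sum : ∀ X Y → Small (X + Y) → Small (X - Y) → Small X
  Small-half-sum X Y p q = Small-double X (begin
    ∣ + 2 * X ∣                        ≡⟨ cong ∣_∣ (half-sum X Y) ⟩
    ∣ (X + Y) + (X - Y) ∣              ≤⟨ ℤₚ.∣i+j∣≤∣i∣+∣j∣ (X + Y) (X - Y) ⟩
    ∣ X + Y ∣ ℕ.+ ∣ X - Y ∣            ≤⟨ ℕₚ.+-mono-≤ p q ⟩
    2                                  ∎)
    where
    open ℕₚ.≤-Reasoning

  tot-even : ∀ {A : Set} (c : A → ℤ) → (∀ p → IsSign (c p)) → ∀ ps i → + length ps ≡ + 2 * i →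
    Small (tot c ps) → tot c ps ≡ 0ℤ
  tot-even c sc ps i even small with tot-parity c sc ps
  ... | l , eq = Small-even (i + l) (trans eq (trans (cong (_+ + 2 * l) even) (sym (ℤₚ.*-distribˡ-+ (+ 2) i l)))) small

  -- All the sums X = tot (f β) ps have the parity of length ps, and likewise Y for qs.  If one of the lengths
  -- is even, the corresponding small sums vanish; if both are odd, X ± Y are small and even, so they vanish.
  small-combinations : ∀ {A B : Set} (f : B → A → ℤ) → (∀ β p → IsSign (f β p)) → ∀ ps qs →
    (∀ β → Small (tot (f β) ps + tot (f β) qs)) → (∀ β → Small (tot (f β) ps - tot (f β) qs)) →
    (∀ β → tot (f β) ps ≡ 0ℤ) ⊎ (∀ β → tot (f β) qs ≡ 0ℤ)
  small-combinations f sf ps qs p q with even∨odd (length ps) | even∨odd (length qs)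
  ... | i , inj₁ e | _ = inj₁ λ β → tot-even (f β) (sf β) ps i e
    (Small-half-sum (tot (f β) ps) (tot (f β) qs) (p β) (q β))
  ... | _ | j , inj₁ e = inj₂ λ β → tot-even (f β) (sf β) qs j e
    (Small-half-sum (tot (f β) qs) (tot (f β) ps)
      (subst Small (ℤₚ.+-comm (tot (f β) ps) (tot (f β) qs)) (p β))
      (subst (ℕ._≤ 1) (ℤₚ.∣i-j∣≡∣j-i∣ (tot (f β) ps) (tot (f β) qs)) (q β)))
  ... | i , inj₂ e | j , inj₂ e′ = inj₁ both-odd
    where
    both-odd : ∀ β → tot (f β) ps ≡ 0ℤ
    both-odd β with tot (f β) ps | tot (f β) qs | p β | q β
                  | tot-parity (f β) (sf β) ps | tot-parity (f β) (sf β) qs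
    ... | X | Y | pβ | qβ | c , X≡ | c′ , Y≡ = ℤₚ.*-cancelˡ-≡ (+ 2) X 0ℤ
      (trans (half-sum X Y) (cong₂ _+_ (Small-even (1ℤ + i + c + j + c′) sum pβ) (Small-even (i + c - j - c′) diff qβ)))
      where
      even⁺ : ∀ i c j c′ → (1ℤ + + 2 * i) + + 2 * c + ((1ℤ + + 2 * j) + + 2 * c′) ≡ + 2 * (1ℤ + i + c + j + c′)
      even⁺ = solve-∀
      even⁻ : ∀ i c j c′ → (1ℤ + + 2 * i) + + 2 * c - ((1ℤ + + 2 * j) + + 2 * c′) ≡ + 2 * (i + c - j - c′)
      even⁻ = solve-∀
      X≡′ = trans X≡ (cong (_+ + 2 * c) e)
      Y≡′ = trans Y≡ (cong (_+ + 2 * c′) e′)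
      sum : X + Y ≡ + 2 * (1ℤ + i + c + j + c′)
      sum = trans (cong₂ _+_ X≡′ Y≡′) (even⁺ i c j c′)
      diff : X - Y ≡ + 2 * (i + c - j - c′)
      diff = trans (cong₂ _-_ X≡′ Y≡′) (even⁻ i c j c′)

  ⟨⟩-weighted-count : ∀ {m} (ε h : Cube m → ℤ) ps → ⟨ h ∙ (λ x → ε x * count ps x) ⟩ ≡ tot (λ x → ε x * h x) ps
  ⟨⟩-weighted-count ε h ps = trans (∑-cong (λ x → assoc (h x) (ε x) (count ps x))) (⟨⟩-count (λ x → ε x * h x) ps)
    where
    assoc : ∀ h e c → h * (e * c) ≡ (e * h) * c
    assoc = solve-∀

  module _ {m : ℕ} (ε : Cube m → ℤ) (sε : ∀ x → IsSign (ε x)) where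

    -- The multiplicity vector twisted by `ε` is a kernel vector. Its product with `ε` is
    -- `length ps`, so it is nonzero, while its coefficient at the full set is a sum of `length ps`
    -- signs.
    annihilated-large : ∀ ps → 1 ℕ.≤ length ps → (∀ α → tot (λ x → ε x * row α x) ps ≡ 0ℤ) →
      2 ^ climbExponent 0 5 m ℕ.≤ length ps
    annihilated-large ps 1≤ zero-rows = ℕₚ.≤-trans
      (kernel-large ε g sε (rows⇒Kernel g (λ α → trans (⟨⟩-weighted-count ε (row α) ps) (zero-rows α))) ⟨ε∙g⟩≢0)
      (subst (λ i → ∣ i ∣ ℕ.≤ length ps) (sym (⟨⟩-weighted-count ε (χ (ones m)) ps))
        (∣tot∣≤length (λ x → ε x * χ (ones m) x) (λ x → IsSign-* (sε x) (χ-sign (ones m) x)) ps))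
      where
      g : Cube m → ℤ
      g x = ε x * count ps x
      square : ∀ {i} → IsSign i → i * i ≡ 1ℤ
      square (inj₁ refl) = refl
      square (inj₂ refl) = refl
      ⟨ε∙g⟩≢0 : ⟨ ε ∙ g ⟩ ≢ 0ℤ
      ⟨ε∙g⟩≢0 e = contradiction (subst (1 ℕ.≤_) (ℤₚ.+-injective
        (trans (sym (trans (⟨⟩-weighted-count ε ε ps) (tot-1 (λ x → ε x * ε x) (square ∘ sε) ps))) e)) 1≤) λ ()

    -- The second block bounds the sums of row totals directly. The first block makes all Walsh
    -- coefficients of the difference `D` small, hence by `small-transform` also the differences of
    -- row totals; parity then annihilates one of the two parts.
    collection-large : ∀ w → 2 ℕ.≤ length w → (∀ α → Small (tot (λ p → column ε p α) w)) →
      2 ^ climbExponent 0 5 m ℕ.≤ length w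
    collection-large w 2≤w boxed = ≤length (small-combinations (λ α x → ε x * row α x) sign ps qs
      (λ α → subst Small (tot-signed (λ p → column ε p (true ∷ α)) w) (boxed (true ∷ α)))
      (λ α → difference (λ x → ε x * row α x) (sign α)))
      where
      sign : ∀ α x → IsSign (ε x * row α x)
      sign α x = IsSign-* (sε x) (row-sign α x)
      ps qs : List (Cube m)
      ps = signed true w
      qs = signed false w
      D : Cube m → ℤ
      D x = 1ℤ * count ps x - 1ℤ * count qs x
      ⟨∙D⟩ : ∀ h → ⟨ h ∙ D ⟩ ≡ tot h ps - tot h qs
      ⟨∙D⟩ h = trans (⟨⟩-linear h (count ps) (count qs) 1ℤ 1ℤ)
        (cong₂ _-_ (trans (ℤₚ.*-identityˡ ⟨ h ∙ count ps ⟩) (⟨⟩-count h ps))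
                   (trans (ℤₚ.*-identityˡ ⟨ h ∙ count qs ⟩) (⟨⟩-count h qs)))
      transform : ∀ α → Small ⟨ χ α ∙ D ⟩
      transform α = subst Small (trans (tot-signed (λ p → column ε p (false ∷ α)) w)
        (trans (cong₂ _+_ (tot-cong (λ x → ℤₚ.*-identityˡ (χ α x)) ps) (tot-neg (χ α) qs)) (sym (⟨∙D⟩ (χ α)))))
        (boxed (false ∷ α))
      difference : ∀ h → (∀ x → IsSign (h x)) → Small (tot h ps - tot h qs)
      difference h sh = subst Small (⟨∙D⟩ h)
        (small-transform h D 1 sh (λ α → ℕₚ.*-mono-≤ (transform α) (transform α)))
      -- Testing `D` with the all-ones vector shows that the lengths differ by at most one, so with
      -- two or more members neither part is empty.
      balanced : Small (+ length ps - + length qs)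
      balanced = subst Small (cong₂ _-_ (tot-1 (λ _ → 1ℤ) (λ _ → refl) ps) (tot-1 (λ _ → 1ℤ) (λ _ → refl) qs))
        (difference (λ _ → 1ℤ) (λ _ → inj₁ refl))
      2≤ : 2 ℕ.≤ length ps ℕ.+ length qs
      2≤ = subst (2 ℕ.≤_) (length-signed w) 2≤w
      nonempty : ∀ a b → Small (+ a - + b) → 2 ℕ.≤ a ℕ.+ b → 1 ℕ.≤ a
      nonempty (suc a) b _ _ = ℕ.s≤s ℕ.z≤n
      nonempty zero    b p q = contradiction
        (subst (ℕ._≤ 1) (trans (cong ∣_∣ (ℤₚ.+-identityˡ (- + b))) (ℤₚ.∣-i∣≡∣i∣ (+ b))) p) (ℕₚ.<⇒≱ q)
      ≤length : (∀ α → tot (λ x → ε x * row α x) ps ≡ 0ℤ) ⊎ (∀ α → tot (λ x → ε x * row α x) qs ≡ 0ℤ) →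
        2 ^ climbExponent 0 5 m ℕ.≤ length w
      ≤length (inj₁ zero-rows) = ℕₚ.≤-trans
        (annihilated-large ps (nonempty (length ps) (length qs) balanced 2≤) zero-rows)
        (subst (length ps ℕ.≤_) (sym (length-signed w)) (ℕₚ.m≤m+n _ _))
      ≤length (inj₂ zero-rows) = ℕₚ.≤-trans
        (annihilated-large qs (nonempty (length qs) (length ps)
          (subst (ℕ._≤ 1) (ℤₚ.∣i-j∣≡∣j-i∣ (+ length ps) (+ length qs)) balanced)
          (subst (2 ℕ.≤_) (ℕₚ.+-comm (length ps) (length qs)) 2≤)) zero-rows)
        (subst (length qs ℕ.≤_) (sym (length-signed w)) (ℕₚ.m≤n+m _ _))

  -- Zero receives the sign 1, so that every value is a sign as the columns require.
  signOf : ℤ → ℤ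
  signOf (+ _)      = 1ℤ
  signOf ℤ.-[1+ _ ] = -1ℤ

  signOf-sign : ∀ i → IsSign (signOf i)
  signOf-sign (+ _)      = inj₁ refl
  signOf-sign ℤ.-[1+ _ ] = inj₂ refl

  signOf-*-∣∣ : ∀ i → signOf i * + ∣ i ∣ ≡ i
  signOf-*-∣∣ (+ n)      = ℤₚ.*-identityˡ (+ n)
  signOf-*-∣∣ ℤ.-[1+ n ] = ℤₚ.-1*i≡-i (+ suc n)

  -- With `ε` the signs of a kernel vector `g`, the multiplicities `∣ g x ∣` are nonnegative. Taking
  -- them for both values of the sign bit cancels the first block, and the kernel equations kill the
  -- second, so the total is exactly zero.
  collection-exists : ∀ m → 5 ℕ.≤ m → ∃ λ (ε : Cube m → ℤ) → (∀ x → IsSign (ε x)) ×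
    ∃ λ w → 2 ℕ.≤ length w × (∀ α → Small (tot (λ p → column ε p α) w))
  collection-exists m 5≤m with kernel-exists m 5≤m
  ... | g , ker , ≢0 = ε , signOf-sign ∘ g , copies true ++ copies false ,
    subst (2 ℕ.≤_) (sym (Listₚ.length-++ (copies true))) (ℕₚ.+-mono-≤ (nonempty true) (nonempty false)) , balanced
    where
    ε : Cube m → ℤ
    ε x = signOf (g x)
    copies : Bool → List (Bool × Cube m)
    copies b = collect (λ x → ∣ g x ∣) (b ,_)
    tot-copies : ∀ b h → tot (λ p → ε (proj₂ p) * h (proj₂ p)) (copies b) ≡ ⟨ h ∙ g ⟩
    tot-copies b h = trans (tot-collect (λ p → ε (proj₂ p) * h (proj₂ p)) (λ x → ∣ g x ∣) (b ,_)) (∑-cong λ x →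
      trans (cong (_* + ∣ g x ∣) (ℤₚ.*-comm (ε x) (h x))) (trans (ℤₚ.*-assoc (h x) (ε x) (+ ∣ g x ∣))
        (cong (h x *_) (signOf-*-∣∣ (g x)))))
    nonempty : ∀ b → 1 ℕ.≤ length (copies b)
    nonempty b = ℕₚ.≤-trans (ℕₚ.n≢0⇒n>0 (≢0 ∘ ℤₚ.∣i∣≡0⇒i≡0))
      (subst (λ i → ∣ i ∣ ℕ.≤ length (copies b)) (tot-copies b (χ (first 5 m)))
        (∣tot∣≤length _ (λ p → IsSign-* (signOf-sign (g (proj₂ p))) (χ-sign (first 5 m) (proj₂ p))) (copies b)))
    zero-total : ∀ α → tot (λ p → column ε p α) (copies true ++ copies false) ≡ 0ℤ
    zero-total (true ∷ α) = trans (tot-++ (λ p → column ε p (true ∷ α)) (copies true) (copies false))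
      (cong₂ _+_ (zero-row true) (zero-row false))
      where
      zero-row : ∀ b → tot (λ p → column ε p (true ∷ α)) (copies b) ≡ 0ℤ
      zero-row b = trans (tot-copies b (row α)) (Kernel⇒rows g ker α)
    zero-total (false ∷ α) = trans (tot-++ c (copies true) (copies false)) (begin
      tot c (copies true) + tot c (copies false)
        ≡⟨ cong₂ _+_ (tot-collect c y (true ,_)) (tot-collect c y (false ,_)) ⟩
      ⟨ (λ x → 1ℤ * χ α x) ∙ (λ x → + y x) ⟩ + ⟨ (λ x → -1ℤ * χ α x) ∙ (λ x → + y x) ⟩
        ≡⟨ ∑-+ (λ x → (1ℤ * χ α x) * + y x) (λ x → (-1ℤ * χ α x) * + y x) ⟨
      ∑ (λ x → (1ℤ * χ α x) * + y x + (-1ℤ * χ α x) * + y x)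
        ≡⟨ ∑-cong (λ x → cancel (χ α x) (+ y x)) ⟩
      ∑ {m} (λ _ → 0ℤ)
        ≡⟨ ∑-const m 0ℤ ⟩
      + (2 ^ m) * 0ℤ
        ≡⟨ ℤₚ.*-zeroʳ (+ (2 ^ m)) ⟩
      0ℤ ∎)
      where
      open ≡-Reasoning
      c : Bool × Cube m → ℤ
      c p = column ε p (false ∷ α)
      y : Cube m → ℕ
      y x = ∣ g x ∣
      cancel : ∀ a b → (1ℤ * a) * b + (-1ℤ * a) * b ≡ 0ℤ
      cancel = solve-∀
    balanced : ∀ α → Small (tot (λ p → column ε p α) (copies true ++ copies false))
    balanced α = subst Small (sym (zero-total α)) ℕ.z≤n

  -- Numbering the coordinates and assembling the bound

  decode : ∀ k → Fin (2 ^ k) → Cube k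
  decode zero    _ = []
  decode (suc k) j = bit (proj₁ (remQuot (2 ^ k) j)) ∷ decode k (proj₂ (remQuot {2} (2 ^ k) j))
    where open Inverse Finₚ.2↔Bool renaming (to to bit)

  -- Brings the box condition back from the numbered coordinates to all of the cube.
  decode-surjective : ∀ {k} (x : Cube k) → ∃ λ j → decode k j ≡ x
  decode-surjective []      = zero , refl
  decode-surjective {suc k} (b ∷ x) with decode-surjective x
  ... | j , refl = combine (from b) j ,
    trans (cong (λ p → to (proj₁ p) ∷ decode k (proj₂ p)) (Finₚ.remQuot-combine {2} (from b) j))
          (cong (_∷ decode k j) (inverseˡ refl))
    where open Inverse Finₚ.2↔Bool

  -- The size bound covers every boxed collection with at least two members, so it survives the
  -- passage to a minimal one.
  admissible-large : ∀ m → 5 ℕ.≤ m → ∃ λ t → Admissible (2 ^ suc m) t × 2 ^ climbExponent 0 5 m ℕ.≤ t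
  admissible-large m 5≤m with collection-exists m 5≤m
  ... | ε , sε , w , 2≤w , balanced
    with minimal-collection (λ p j → column ε p (decode (suc m) j)) (λ p j → column-sign ε sε p (decode (suc m) j))
           (length w) w ℕₚ.≤-refl 2≤w (λ j → balanced (decode (suc m) j))
  ... | w′ , 2≤w′ , boxed , valid = length w′ , (_ , valid) , collection-large ε sε w′ 2≤w′ boxed′
    where
    boxed′ : ∀ α → Small (tot (λ p → column ε p α) w′)
    boxed′ α with decode-surjective α
    ... | j , refl = boxed j

  singleton-admissible : ∀ d → Admissible d 1
  singleton-admissible d = (λ _ _ → 1ℤ) , (λ _ _ → inj₁ refl) , (λ _ → ℤ.-≤+ , ℤₚ.≤-refl) ,
    λ S 2≤S S<1 _ → ℕₚ.<⇒≱ S<1 (ℕₚ.≤-trans (ℕ.s≤s ℕ.z≤n) 2≤S)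

  -- For `N = 2 ^ m` the exponent bound gives `N * m ≤ 2 * E + 10 * N`; doubling and moving `10 * N`
  -- to the left replaces `m` by `m - 10`.
  exponent-large : ∀ m j → m ≡ 10 ℕ.+ j → 2 ^ suc m ℕ.* j ℕ.≤ climbExponent 0 5 m ℕ.* 4
  exponent-large m j m≡ = ℕₚ.+-cancelʳ-≤ (2 ℕ.* (10 ℕ.+ 10 ℕ.* N)) _ _ (begin
    2 ℕ.* N ℕ.* j ℕ.+ 2 ℕ.* (10 ℕ.+ 10 ℕ.* N)
      ≡⟨ arrange N j ⟩
    2 ℕ.* (N ℕ.* (2 ℕ.* 0 ℕ.+ (10 ℕ.+ j)) ℕ.+ 10)
      ≡⟨ cong (λ x → 2 ℕ.* (N ℕ.* (2 ℕ.* 0 ℕ.+ x) ℕ.+ 10)) m≡ ⟨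
    2 ℕ.* (N ℕ.* (2 ℕ.* 0 ℕ.+ m) ℕ.+ 10)
      ≤⟨ ℕₚ.*-monoʳ-≤ 2 (climbExponent-bound 0 5 m (inj₂ ℕₚ.≤-refl)) ⟩
    2 ℕ.* (2 ℕ.* E ℕ.+ 2 ℕ.* 5 ℕ.+ 10 ℕ.* N)
      ≡⟨ arrange′ E N ⟩
    E ℕ.* 4 ℕ.+ 2 ℕ.* (10 ℕ.+ 10 ℕ.* N) ∎)
    where
    open ℕₚ.≤-Reasoning
    N E : ℕ
    N = 2 ^ m
    E = climbExponent 0 5 m
    arrange : ∀ N j → 2 ℕ.* N ℕ.* j ℕ.+ 2 ℕ.* (10 ℕ.+ 10 ℕ.* N) ≡ 2 ℕ.* (N ℕ.* (2 ℕ.* 0 ℕ.+ (10 ℕ.+ j)) ℕ.+ 10)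
    arrange = ℕSolver.solve-∀
    arrange′ : ∀ E N → 2 ℕ.* (2 ℕ.* E ℕ.+ 2 ℕ.* 5 ℕ.+ 10 ℕ.* N) ≡ E ℕ.* 4 ℕ.+ 2 ℕ.* (10 ℕ.+ 10 ℕ.* N)
    arrange′ = ℕSolver.solve-∀

-- Passage to rational powers

open Construction using (climbExponent; admissible-large; singleton-admissible; exponent-large)
open import Data.Rational using (ℚ; 0ℚ; _<_; _≤_; _*_)

ℕtoℚ-≃ : ∀ n → ℚ.toℚᵘ (ℕtoℚ n) ℚᵘ.≃ ℚᵘ.mkℚᵘ (+ n) 0
ℕtoℚ-≃ n = ℚₚ.toℚᵘ-fromℚᵘ (ℚᵘ.mkℚᵘ (+ n) 0)

ℕtoℚ-* : ∀ a b → ℕtoℚ (a ℕ.* b) ≡ ℕtoℚ a * ℕtoℚ b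
ℕtoℚ-* a b = ℚₚ.toℚᵘ-injective (ℚᵘₚ.≃-trans (ℕtoℚ-≃ (a ℕ.* b)) (ℚᵘₚ.≃-trans
  (ℚᵘ.*≡* (cong (ℤ._* + 1) (ℤₚ.pos-* a b)))
  (ℚᵘₚ.≃-sym (ℚᵘₚ.≃-trans (ℚₚ.toℚᵘ-homo-* (ℕtoℚ a) (ℕtoℚ b)) (ℚᵘₚ.*-cong (ℕtoℚ-≃ a) (ℕtoℚ-≃ b))))))

ℕtoℚ-mono-≤ : ∀ {a b} → a ℕ.≤ b → ℕtoℚ a ≤ ℕtoℚ b
ℕtoℚ-mono-≤ {a} {b} a≤b = ℚₚ.toℚᵘ-cancel-≤ (ℚᵘₚ.≤-trans (ℚᵘₚ.≤-reflexive (ℕtoℚ-≃ a)) (ℚᵘₚ.≤-trans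
  (ℚᵘ.*≤* (ℤₚ.*-monoʳ-≤-nonNeg (+ 1) (ℤ.+≤+ a≤b)))
  (ℚᵘₚ.≤-reflexive (ℚᵘₚ.≃-sym (ℕtoℚ-≃ b)))))

ℕtoℚ-^ : ∀ a n → ℕtoℚ (a ^ n) ≡ ℕtoℚ a ^ℚ n
ℕtoℚ-^ a zero    = refl
ℕtoℚ-^ a (suc n) = trans (ℕtoℚ-* a (a ^ n)) (cong (ℕtoℚ a *_) (ℕtoℚ-^ a n))

^ℚ-≤1 : ∀ q .{{_ : ℚ.NonNegative q}} → q ≤ ℚ.1ℚ → ∀ n → q ^ℚ n ≤ ℚ.1ℚ
^ℚ-≤1 q q≤1 zero    = ℚₚ.≤-refl
^ℚ-≤1 q q≤1 (suc n) = ℚₚ.≤-trans (ℚₚ.*-monoˡ-≤-nonNeg q (^ℚ-≤1 q q≤1 n))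
  (ℚₚ.≤-trans (ℚₚ.≤-reflexive (ℚₚ.*-identityʳ q)) q≤1)

-- 2048 is 2 to the power 11: one factor 2 comes from the two blocks, ten from the loss in
-- `exponent-large`.
c₀ : ℚ
c₀ = (+ 1) ℚ./ 2048

c₀*2^ : ∀ k j → k ≡ 11 ℕ.+ j → c₀ * ℕtoℚ (2 ^ k) ≡ ℕtoℚ (2 ^ j)
c₀*2^ k j k≡ = begin
  c₀ * ℕtoℚ (2 ^ k)                    ≡⟨ cong (λ n → c₀ * ℕtoℚ n) (trans (cong (2 ^_) k≡) (ℕₚ.^-distribˡ-+-* 2 11 j)) ⟩
  c₀ * ℕtoℚ (2048 ℕ.* 2 ^ j)           ≡⟨ cong (c₀ *_) (ℕtoℚ-* 2048 (2 ^ j)) ⟩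
  c₀ * (ℕtoℚ 2048 * ℕtoℚ (2 ^ j))      ≡⟨ ℚₚ.*-assoc c₀ (ℕtoℚ 2048) (ℕtoℚ (2 ^ j)) ⟨
  -- The product `c₀ * ℕtoℚ 2048` evaluates to `ℚ.1ℚ`.
  ℚ.1ℚ * ℕtoℚ (2 ^ j)                  ≡⟨ ℚₚ.*-identityˡ (ℕtoℚ (2 ^ j)) ⟩
  ℕtoℚ (2 ^ j)                         ∎
  where open ≡-Reasoning

large-case : ∀ k j → k ≡ 11 ℕ.+ j → ∃ λ t → Admissible (2 ^ k) t ×
  ((c₀ * ℕtoℚ (2 ^ k)) ^ℚ (2 ^ k) ≤ ℕtoℚ t ^ℚ 4)
large-case (suc m) j k≡ = t , proj₁ (proj₂ large) , (begin
  (c₀ * ℕtoℚ d) ^ℚ d     ≡⟨ cong (_^ℚ d) (c₀*2^ (suc m) j k≡) ⟩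
  ℕtoℚ (2 ^ j) ^ℚ d      ≡⟨ ℕtoℚ-^ (2 ^ j) d ⟨
  ℕtoℚ ((2 ^ j) ^ d)     ≤⟨ ℕtoℚ-mono-≤ power ⟩
  ℕtoℚ (t ^ 4)           ≡⟨ ℕtoℚ-^ t 4 ⟩
  ℕtoℚ t ^ℚ 4            ∎)
  where
  open ℚₚ.≤-Reasoning
  large = admissible-large m (subst (5 ℕ.≤_) (sym (ℕₚ.suc-injective k≡)) (ℕₚ.m≤m+n 5 (5 ℕ.+ j)))
  t d E : ℕ
  t = proj₁ large
  d = 2 ^ suc m
  E = climbExponent 0 5 m
  power : (2 ^ j) ^ d ℕ.≤ t ^ 4
  power = ℕₚ.≤-trans
    (ℕₚ.≤-reflexive (trans (ℕₚ.^-*-assoc 2 j d) (cong (2 ^_) (ℕₚ.*-comm j d))))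
    (ℕₚ.≤-trans (ℕₚ.^-monoʳ-≤ 2 (exponent-large m j (ℕₚ.suc-injective k≡)))
    (ℕₚ.≤-trans (ℕₚ.≤-reflexive (sym (ℕₚ.^-*-assoc 2 E 4))) (ℕₚ.^-monoˡ-≤ 4 (proj₂ (proj₂ large)))))

-- Up to dimension 2048 the base is at most 1, so a single vector suffices.
small-case : ∀ k → k ℕ.≤ 11 → (c₀ * ℕtoℚ (2 ^ k)) ^ℚ (2 ^ k) ≤ ℕtoℚ 1 ^ℚ 4
small-case k k≤11 = ^ℚ-≤1 (c₀ * ℕtoℚ (2 ^ k)) {{ℚ.nonNegative 0≤}}
  (ℚₚ.*-monoˡ-≤-nonNeg c₀ (ℕtoℚ-mono-≤ (ℕₚ.^-monoʳ-≤ 2 k≤11))) (2 ^ k)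
  where
  0≤ : 0ℚ ≤ c₀ * ℕtoℚ (2 ^ k)
  0≤ = ℚₚ.*-monoˡ-≤-nonNeg c₀ (ℕtoℚ-mono-≤ {0} {2 ^ k} ℕ.z≤n)

-- An admissible `t` is a lower bound for the maximum, and fourth powers avoid the exponent d/4,
-- which is not an integer for d = 1 and d = 2.
theorem3 : ∃ λ (c : ℚ) → (0ℚ < c) ×
    (∀ (k : ℕ) → ∃ λ (t : ℕ) → Admissible (2 ^ k) t ×
    ((c * ℕtoℚ (2 ^ k)) ^ℚ (2 ^ k) ≤ ℕtoℚ t ^ℚ 4))
theorem3 = c₀ , ℚₚ.positive⁻¹ c₀ , λ k → [ at-least-11 k , at-most-11 k ]′ (ℕₚ.≤-total 11 k)
  where
  at-least-11 : ∀ k → 11 ℕ.≤ k → ∃ λ t → Admissible (2 ^ k) t × ((c₀ * ℕtoℚ (2 ^ k)) ^ℚ (2 ^ k) ≤ ℕtoℚ t ^ℚ 4)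
  at-least-11 k 11≤k = large-case k (k ∸ 11) (sym (ℕₚ.m+[n∸m]≡n 11≤k))
  at-most-11 : ∀ k → k ℕ.≤ 11 → ∃ λ t → Admissible (2 ^ k) t × ((c₀ * ℕtoℚ (2 ^ k)) ^ℚ (2 ^ k) ≤ ℕtoℚ t ^ℚ 4)
  at-most-11 k k≤11 = 1 , singleton-admissible (2 ^ k) , small-case k k≤11
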